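{- For the two-stage minmax regret selection problem, the maximum regret $Z(\pmb{x})$ of a given first-stage solution $\pmb{x}\in\mathcal{X}'_{\mathcal{S}}$ can be computed in $O(n^2)$ time.
   Context: $[n]=\{1,\dots,n\}$ and $p\in[n]$ is fixed. The feasible set of the selection problem is $\mathcal{X}_{\mathcal{S}}=\{\pmb{x}\in\{0,1\}^n:x_1+\dots+x_n=p\}$. For $\pmb{x}\in\{0,1\}^n$ let $\mathcal{R}(\pmb{x})=\{\pmb{y}\in\{0,1\}^n:\pmb{x}+\pmb{y}\in\mathcal{X}_{\mathcal{S}}\}$ be the set of recourse actions. The set of feasible first-stage solutions is $\mathcal{X}'_{\mathcal{S}}=\{\pmb{x}\in\{0,1\}^n:\mathcal{R}(\pmb{x})\ne\emptyset\}=\{\pmb{x}\in\{0,1\}^n:x_1+\dots+x_n\le p\}$, and $\mathcal{Z}=\{(\pmb{x},\pmb{y})\in\{0,1\}^{2n}:\pmb{x}\in\mathcal{X}'_{\mathcal{S}},\ \pmb{y}\in\mathcal{R}(\pmb{x})\}$. The input consists of $n$, $p$, a nonnegative first-stage cost vector $\pmb{C}\in\mathbb{R}_+^n$, intervals $[\underline{c}_i,\overline{c}_i]$ with $0\le\underline{c}_i\le\overline{c}_i$, $i\in[n]$, and $\pmb{x}\in\mathcal{X}'_{\mathcal{S}}$. The set of second-stage scenarios is $\mathcal{U}=\prod_{i\in[n]}[\underline{c}_i,\overline{c}_i]$. For $\pmb{c}\in\mathcal{U}$: $$\mathrm{Opt}(\pmb{c})=\min_{(\pmb{x},\pmb{y})\in\mathcal{Z}}(\pmb{C}^T\pmb{x}+\pmb{c}^T\pmb{y}),\qquad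 \mathrm{Inc}(\pmb{x},\pmb{c})=\pmb{C}^T\pmb{x}+\min_{\pmb{y}\in\mathcal{R}(\pmb{x})}\pmb{c}^T\pmb{y},$$ $$Z(\pmb{x})=\max_{\pmb{c}\in\mathcal{U}}\left(\mathrm{Inc}(\pmb{x},\pmb{c})-\mathrm{Opt}(\pmb{c})\right).$$ Running time is counted in the usual way, with elementary arithmetic operations and comparisons of numbers at unit cost. -}

module Defs where

open import Level using (Level; suc; _⊔_; 0ℓ)
open import Algebra.Bundles using (CommutativeRing)
open import Algebra.Structures using (IsCommutativeRing)
import Algebra.Definitions.RawMonoid as RawMonoidDefs
open import Data.Bool using (Bool; true; false; _∧_; not; if_then_else_)
open import Data.Nat as ℕ using (ℕ; zero; _∸_; _≤ᵇ_; _≡ᵇ_)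
open import Data.Nat.Base using (+-0-rawMonoid)
open import Data.Product using (∃-syntax; _×_; _,_)
open import Data.Vec.Functional using (Vector; zipWith; head; tail)
open import Relation.Binary using (Rel; IsDecTotalOrder)
open import Relation.Binary.PropositionalEquality using (_≡_)
open import Relation.Nullary using (¬_; does)
open import Relation.Unary using (Pred; _∈_; Satisfiable)

-- agda-stdlib has no real numbers, so costs range over an arbitrary
-- totally ordered field whose order is decidable, as comparison is a
-- primitive operation of the machine below.  Classically, ℝ is one.
record OrderedField c ℓ₁ ℓ₂ : Set (suc (c ⊔ ℓ₁ ⊔ ℓ₂)) where
  infix  8 -_
  infix  9 _⁻¹
  infixl 7 _*_
  infixl 6 _+_ _-_
  infix  4 _≈_ _≤_
  field
    Carrier           : Set c
    _≈_               : Rel Carrier ℓ₁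
    _≤_               : Rel Carrier ℓ₂
    _+_ _*_           : Carrier → Carrier → Carrier
    -_                : Carrier → Carrier
    0# 1#             : Carrier
    -- Total; the value of 0# ⁻¹ is unconstrained.
    _⁻¹               : Carrier → Carrier
    isCommutativeRing : IsCommutativeRing _≈_ _+_ _*_ -_ 0# 1#
    isDecTotalOrder   : IsDecTotalOrder _≈_ _≤_
    0≉1               : ¬ (0# ≈ 1#)
    ⁻¹-cong           : ∀ {x y} → x ≈ y → x ⁻¹ ≈ y ⁻¹
    *-inverseʳ        : ∀ x → ¬ (x ≈ 0#) → x * x ⁻¹ ≈ 1#
    +-monoʳ-≤         : ∀ x {y z} → y ≤ z → x + y ≤ x + z
    *-nonNegative     : ∀ {x y} → 0# ≤ x → 0# ≤ y → 0# ≤ x * y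

  _-_ : Carrier → Carrier → Carrier
  x - y = x + (- y)

  commutativeRing : CommutativeRing c ℓ₁
  commutativeRing = record { isCommutativeRing = isCommutativeRing }

  open IsDecTotalOrder isDecTotalOrder public using (_≤?_)

-- Binary vectors are ℕ-valued, so that x + y is the componentwise sum.

infixl 6 _+ᵛ_

_+ᵛ_ : ∀ {n} → Vector ℕ n → Vector ℕ n → Vector ℕ n
_+ᵛ_ = zipWith ℕ._+_

sumℕ : ∀ {n} → Vector ℕ n → ℕ
sumℕ = RawMonoidDefs.sum +-0-rawMonoid

Binary : ∀ {n} → Pred (Vector ℕ n) 0ℓ
Binary x = ∀ i → x i ℕ.≤ 1

-- 𝒳_S
Selection : ∀ {n} → ℕ → Pred (Vector ℕ n) 0ℓ
Selection p x = Binary x × sumℕ x ≡ p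

-- ℛ(x)
Recourse : ∀ {n} → ℕ → Vector ℕ n → Pred (Vector ℕ n) 0ℓ
Recourse p x y = Binary y × (x +ᵛ y) ∈ Selection p

-- 𝒳′_S
FirstStage : ∀ {n} → ℕ → Pred (Vector ℕ n) 0ℓ
FirstStage p x = Binary x × Satisfiable (Recourse p x)

-- 𝒵
TwoStage : ∀ {n} → ℕ → Pred (Vector ℕ n × Vector ℕ n) 0ℓ
TwoStage p (x , y) = x ∈ FirstStage p × y ∈ Recourse p x

module Regret {c ℓ₁ ℓ₂ : Level} (F : OrderedField c ℓ₁ ℓ₂) where
  open OrderedField F
  open RawMonoidDefs (CommutativeRing.+-rawMonoid commutativeRing)
    using (sum) renaming (_×_ to _·_)

  IsMin IsMax : ∀ {ℓ} → Pred Carrier ℓ → Pred Carrier (c ⊔ ℓ₂ ⊔ ℓ)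
  IsMin V m = m ∈ V × (∀ {v} → v ∈ V → m ≤ v)
  IsMax V m = m ∈ V × (∀ {v} → v ∈ V → v ≤ m)

  infix 7 _ᵀ_

  _ᵀ_ : ∀ {n} → Vector Carrier n → Vector ℕ n → Carrier
  a ᵀ x = sum (λ i → x i · a i)

  record Instance (n : ℕ) : Set (c ⊔ ℓ₂) where
    field
      p     : ℕ
      1≤p   : 1 ℕ.≤ p
      p≤n   : p ℕ.≤ n
      C     : Vector Carrier n
      lower : Vector Carrier n
      upper : Vector Carrier n
      0≤C           : ∀ i → 0# ≤ C i
      0≤lower       : ∀ i → 0# ≤ lower i
      lower≤upper   : ∀ i → lower i ≤ upper i

  module _ {n : ℕ} (I : Instance n) where
    open Instance I

    -- 𝒰
    Scenario : Pred (Vector Carrier n) ℓ₂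
    Scenario s = ∀ i → lower i ≤ s i × s i ≤ upper i

    -- The minima and maxima below are relations "v is the value of …";
    -- values are unique up to _≈_ by antisymmetry.

    IsOpt : Vector Carrier n → Pred Carrier (c ⊔ ℓ₁ ⊔ ℓ₂)
    IsOpt s = IsMin λ v →
      ∃[ x ] ∃[ y ] (x , y) ∈ TwoStage p × v ≈ C ᵀ x + s ᵀ y

    IsInc : Vector ℕ n → Vector Carrier n → Pred Carrier (c ⊔ ℓ₁ ⊔ ℓ₂)
    IsInc x s v = ∃[ m ]
      IsMin (λ w → ∃[ y ] y ∈ Recourse p x × w ≈ s ᵀ y) m × v ≈ C ᵀ x + m

    IsMaxRegret : Vector ℕ n → Pred Carrier (c ⊔ ℓ₁ ⊔ ℓ₂)
    IsMaxRegret x = IsMax λ v →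
      ∃[ s ] ∃[ inc ] ∃[ opt ]
        s ∈ Scenario × IsInc x s inc × IsOpt s opt × v ≈ inc - opt

-- Real RAM, as a structured language: unit-cost arithmetic and
-- comparison of numbers, and also unit cost for control, index
-- arithmetic and memory access.  Memory consists of arrays of
-- naturals (for indices and control) and arrays of numbers, with
-- indirect addressing; array names are static, so a program uses only
-- finitely many arrays.  Naturals have only + and ∸, which keeps
-- unit-cost arithmetic on them harmless.

infixl 6 _⊕_ _⊖_ _+ᴺ_ _-ᴺ_
infixl 7 _*ᴺ_ _/ᴺ_
infix  4 _≤ᴵ_ _≤ᴺ_
infix  3 int_[_]≔_ num_[_]≔_
infixr 2 _⨾_

data IExp : Set where
  lit     : ℕ → IExp
  int_[_] : ℕ → IExp → IExp
  _⊕_ _⊖_ : IExp → IExp → IExp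

data NExp : Set where
  0ᴺ 1ᴺ               : NExp
  num_[_]             : ℕ → IExp → NExp
  _+ᴺ_ _-ᴺ_ _*ᴺ_ _/ᴺ_ : NExp → NExp → NExp

data Test : Set where
  _≤ᴵ_ : IExp → IExp → Test
  _≤ᴺ_ : NExp → NExp → Test
  notᵀ : Test → Test

data Program : Set where
  skip       : Program
  int_[_]≔_  : ℕ → IExp → IExp → Program
  num_[_]≔_  : ℕ → IExp → NExp → Program
  _⨾_        : Program → Program → Program
  ifᴾ_then_else_ : Test → Program → Program → Program
  while_loop_  : Test → Program → Program

-- Every node of an expression costs one unit.

costᴵ : IExp → ℕ
costᴵ (lit _)       = 1
costᴵ (int _ [ e ]) = 1 ℕ.+ costᴵ e
costᴵ (e ⊕ f)       = 1 ℕ.+ costᴵ e ℕ.+ costᴵ f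
costᴵ (e ⊖ f)       = 1 ℕ.+ costᴵ e ℕ.+ costᴵ f

costᴺ : NExp → ℕ
costᴺ 0ᴺ            = 1
costᴺ 1ᴺ            = 1
costᴺ (num _ [ e ]) = 1 ℕ.+ costᴵ e
costᴺ (e +ᴺ f)      = 1 ℕ.+ costᴺ e ℕ.+ costᴺ f
costᴺ (e -ᴺ f)      = 1 ℕ.+ costᴺ e ℕ.+ costᴺ f
costᴺ (e *ᴺ f)      = 1 ℕ.+ costᴺ e ℕ.+ costᴺ f
costᴺ (e /ᴺ f)      = 1 ℕ.+ costᴺ e ℕ.+ costᴺ f

costᵀ : Test → ℕ
costᵀ (e ≤ᴵ f) = 1 ℕ.+ costᴵ e ℕ.+ costᴵ f
costᵀ (e ≤ᴺ f) = 1 ℕ.+ costᴺ e ℕ.+ costᴺ f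
costᵀ (notᵀ b) = 1 ℕ.+ costᵀ b

-- Array name, then index.
Memory : ∀ {a} → Set a → Set a
Memory A = ℕ → ℕ → A

write : ∀ {a} {A : Set a} → ℕ → ℕ → A → Memory A → Memory A
write a i v m b j = if (a ≡ᵇ b) ∧ (i ≡ᵇ j) then v else m b j

-- A vector as an infinite array, padded with d.
load : ∀ {a} {A : Set a} {n} → A → Vector A n → ℕ → A
load {n = zero}    d v _         = d
load {n = ℕ.suc _} d v zero      = head v
load {n = ℕ.suc _} d v (ℕ.suc i) = load d (tail v) i

module Machine {c ℓ₁ ℓ₂ : Level} (F : OrderedField c ℓ₁ ℓ₂) where
  open OrderedField F
  open Regret F using (Instance)

  record State : Set c where
    constructor ⟪_,_⟫
    field
      ints : Memory ℕ
      nums : Memory Carrier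
  open State public

  ⟦_⟧ᴵ : IExp → State → ℕ
  ⟦ lit k ⟧ᴵ       σ = k
  ⟦ int a [ e ] ⟧ᴵ σ = ints σ a (⟦ e ⟧ᴵ σ)
  ⟦ e ⊕ f ⟧ᴵ       σ = ⟦ e ⟧ᴵ σ ℕ.+ ⟦ f ⟧ᴵ σ
  ⟦ e ⊖ f ⟧ᴵ       σ = ⟦ e ⟧ᴵ σ ∸ ⟦ f ⟧ᴵ σ

  ⟦_⟧ᴺ : NExp → State → Carrier
  ⟦ 0ᴺ ⟧ᴺ          σ = 0#
  ⟦ 1ᴺ ⟧ᴺ          σ = 1#
  ⟦ num a [ e ] ⟧ᴺ σ = nums σ a (⟦ e ⟧ᴵ σ)
  ⟦ e +ᴺ f ⟧ᴺ      σ = ⟦ e ⟧ᴺ σ + ⟦ f ⟧ᴺ σ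
  ⟦ e -ᴺ f ⟧ᴺ      σ = ⟦ e ⟧ᴺ σ - ⟦ f ⟧ᴺ σ
  ⟦ e *ᴺ f ⟧ᴺ      σ = ⟦ e ⟧ᴺ σ * ⟦ f ⟧ᴺ σ
  ⟦ e /ᴺ f ⟧ᴺ      σ = ⟦ e ⟧ᴺ σ * ⟦ f ⟧ᴺ σ ⁻¹

  ⟦_⟧ᵀ : Test → State → Bool
  ⟦ e ≤ᴵ f ⟧ᵀ σ = ⟦ e ⟧ᴵ σ ≤ᵇ ⟦ f ⟧ᴵ σ
  ⟦ e ≤ᴺ f ⟧ᵀ σ = does (⟦ e ⟧ᴺ σ ≤? ⟦ f ⟧ᴺ σ)
  ⟦ notᵀ b ⟧ᵀ σ = not (⟦ b ⟧ᵀ σ)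

  infix 4 ⟨_,_⟩⇓_in-time_

  -- ⟨ P , σ ⟩⇓ σ′ in-time t : started in σ, the program P terminates in
  -- state σ′ after exactly t units of time.
  data ⟨_,_⟩⇓_in-time_ : Program → State → State → ℕ → Set c where
    skip⇓  : ∀ {σ} → ⟨ skip , σ ⟩⇓ σ in-time 1
    int⇓   : ∀ {σ a i e} →
             ⟨ (int a [ i ]≔ e) , σ ⟩⇓
             ⟪ write a (⟦ i ⟧ᴵ σ) (⟦ e ⟧ᴵ σ) (ints σ) , nums σ ⟫
             in-time (1 ℕ.+ costᴵ i ℕ.+ costᴵ e)
    num⇓   : ∀ {σ a i e} →
             ⟨ (num a [ i ]≔ e) , σ ⟩⇓
             ⟪ ints σ , write a (⟦ i ⟧ᴵ σ) (⟦ e ⟧ᴺ σ) (nums σ) ⟫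
             in-time (1 ℕ.+ costᴵ i ℕ.+ costᴺ e)
    seq⇓   : ∀ {P Q σ σ′ σ″ t u} →
             ⟨ P , σ ⟩⇓ σ′ in-time t →
             ⟨ Q , σ′ ⟩⇓ σ″ in-time u →
             ⟨ (P ⨾ Q) , σ ⟩⇓ σ″ in-time (t ℕ.+ u)
    then⇓  : ∀ {b P Q σ σ′ t} → ⟦ b ⟧ᵀ σ ≡ true →
             ⟨ P , σ ⟩⇓ σ′ in-time t →
             ⟨ (ifᴾ b then P else Q) , σ ⟩⇓ σ′ in-time (1 ℕ.+ costᵀ b ℕ.+ t)
    else⇓  : ∀ {b P Q σ σ′ t} → ⟦ b ⟧ᵀ σ ≡ false →
             ⟨ Q , σ ⟩⇓ σ′ in-time t →
             ⟨ (ifᴾ b then P else Q) , σ ⟩⇓ σ′ in-time (1 ℕ.+ costᵀ b ℕ.+ t)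
    stop⇓  : ∀ {b P σ} → ⟦ b ⟧ᵀ σ ≡ false →
             ⟨ (while b loop P) , σ ⟩⇓ σ in-time (1 ℕ.+ costᵀ b)
    loop⇓  : ∀ {b P σ σ′ σ″ t u} → ⟦ b ⟧ᵀ σ ≡ true →
             ⟨ P , σ ⟩⇓ σ′ in-time t →
             ⟨ (while b loop P) , σ′ ⟩⇓ σ″ in-time u →
             ⟨ (while b loop P) , σ ⟩⇓ σ″ in-time (1 ℕ.+ costᵀ b ℕ.+ t ℕ.+ u)

  module _ {n : ℕ} (I : Instance n) (x : Vector ℕ n) where
    open Instance I

    inputInts : Memory ℕ
    inputInts 0 0 = n
    inputInts 0 1 = p
    inputInts 1 i = load 0 x i
    inputInts _ _ = 0

    inputNums : Memory Carrier
    inputNums 0 i = load 0# C i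
    inputNums 1 i = load 0# lower i
    inputNums 2 i = load 0# upper i
    inputNums _ _ = 0#

    input : State
    input = ⟪ inputInts , inputNums ⟫

  output : State → Carrier
  output σ = nums σ 3 0

O : (ℕ → ℕ) → Pred (ℕ → ℕ) 0ℓ
O g T = ∃[ K ] ∃[ N ] (∀ n → N ℕ.≤ n → T n ℕ.≤ K ℕ.* g n)

{-# OPTIONS --safe #-}
-- Let a(i) = 1 − x(i).  By linear programming duality, the cheapest recourse
-- in the scenario s costs the maximum over thresholds α of
-- Σ a(i) min(α, s(i)) − (n − p) α, attained at α = 0 or at some s(i).  Hence
-- Z(x) is the maximum over α of a function V(α), for which the best scenario
-- sets s(i) to its lower bound where the adversary buys i in the second stage
-- and to its upper bound elsewhere.  The adversary then buys the p cheapest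
-- elements at the prices w(i) = max(l(i), min(u(i), α)), where
-- l = min(C, lower), and u = min(C, upper) off x, u = l on x.  Only the 2n + 1
-- values 0, lower(i), upper(i) of α matter, so each V(α) must be found in
-- linear time, without sorting.
--
-- An order of the elements by w also sorts max(l, α) and min(u, α), whose sum
-- is w + α.  The p cheapest elements for max(l, α) are those for l, so their
-- total is again given by the dual sum, at the threshold max(θl, α), where θl
-- is an optimal threshold for l; likewise for u.  The thresholds θl and θu do
-- not depend on α, and are found beforehand as maximisers of the dual sums
-- over the values of l and u.
module Submission where

open import Defs
open import Algebra.Bundles using (CommutativeRing)
open import Algebra.Construct.NaturalChoice.Base using (MinOperator; MaxOperator)
import Algebra.Construct.NaturalChoice.MinMaxOp as MinMaxOp
import Algebra.Properties.CommutativeMonoid.Mult as CommutativeMonoidMult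
import Algebra.Properties.CommutativeMonoid.Sum as CommutativeMonoidSum
import Algebra.Properties.Group as GroupProperties
import Algebra.Properties.Monoid.Mult as MonoidMult
import Algebra.Solver.CommutativeMonoid as CommutativeMonoidSolver
open import Data.Bool using (Bool; true; false; if_then_else_)
open import Data.Bool.Properties using (T-≡)
open import Data.Fin using (Fin; zero; suc; toℕ)
import Data.Fin.Properties as Fin
open import Data.List using (List; []; _∷_; _++_)
open import Data.Nat as ℕ using (ℕ; zero; suc; _∸_; _^_; _≤ᵇ_; _≡ᵇ_; z≤n; s≤s)
import Data.Nat.Properties as ℕ
open import Data.Product using (∃-syntax; _×_; _,_; proj₁; proj₂; map₂)
open import Data.Sum using (_⊎_; inj₁; inj₂)
open import Data.Vec.Functional using (Vector; head; tail; updateAt)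
open import Data.Vec.Functional.Properties using (updateAt-updates; updateAt-minimal)
open import Function using (_∘_; Equivalence)
open import Relation.Binary using (IsDecTotalOrder; TotalPreorder; Poset)
open import Relation.Binary.PropositionalEquality as ≡ using (_≡_; refl)
import Relation.Binary.Reasoning.PartialOrder as PosetReasoning
open import Relation.Nullary using (does; yes; no; contradiction)
open import Relation.Unary using (_∈_; Pred)

-- Counting with binary vectors.

module ℕΣ = CommutativeMonoidSum ℕ.+-0-commutativeMonoid

sumℕ-ones : ∀ {n} (z : Vector ℕ n) → (∀ i → z i ≡ 1) → sumℕ z ≡ n
sumℕ-ones {zero}  z ones = refl
sumℕ-ones {suc n} z ones = ≡.cong₂ ℕ._+_ (ones zero) (sumℕ-ones (tail z) (ones ∘ suc))

sumℕ-complement : ∀ {n} (z : Vector ℕ n) → Binary z → sumℕ (λ i → 1 ∸ z i) ℕ.+ sumℕ z ≡ n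
sumℕ-complement {n} z bin = ≡.trans (≡.sym (ℕΣ.∑-distrib-+ (λ i → 1 ∸ z i) z))
  (≡.trans (ℕΣ.sum-cong-≋ (λ i → ℕ.m∸n+n≡m (bin i))) (sumℕ-ones {n} _ (λ _ → refl)))

sumℕ-updateAt-suc : ∀ {n} (z : Vector ℕ n) j → sumℕ (updateAt z j suc) ≡ suc (sumℕ z)
sumℕ-updateAt-suc z zero    = refl
sumℕ-updateAt-suc z (suc j) =
  ≡.trans (≡.cong (z zero ℕ.+_) (sumℕ-updateAt-suc (tail z) j)) (ℕ.+-suc (z zero) _)

-- Σᵢ slack p i · θ stands for (n ∸ p) · θ; the machine obtains it without
-- converting a natural to a number.
slack : ∀ {n} → ℕ → Vector ℕ n
slack p i = if p ≤ᵇ toℕ i then 1 else 0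

sumℕ-slack : ∀ {n} p → p ℕ.≤ n → sumℕ {n} (slack p) ≡ n ∸ p
sumℕ-slack {zero}  zero    _         = refl
sumℕ-slack {suc n} zero    _         = ≡.cong suc (sumℕ-slack {n} zero z≤n)
sumℕ-slack {suc n} (suc p) (s≤s p≤n) =
  ≡.trans (ℕΣ.sum-cong-≗ (λ i → ≡.cong (if_then 1 else 0) (<ᵇ-suc p (toℕ {n} i)))) (sumℕ-slack p p≤n)
  where
  <ᵇ-suc : ∀ p i → (p ℕ.<ᵇ suc i) ≡ (p ≤ᵇ i)
  <ᵇ-suc zero    i = refl
  <ᵇ-suc (suc p) i = refl

-- Minima, maxima and finite sums in an ordered field.

module OrderedFieldProperties {c ℓ₁ ℓ₂} (F : OrderedField c ℓ₁ ℓ₂) where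
  open OrderedField F
  open IsDecTotalOrder isDecTotalOrder public
    using (antisym; total; isPartialOrder; ≤-respˡ-≈; ≤-respʳ-≈)
    renaming (refl to ≤-refl; trans to ≤-trans; reflexive to ≤-reflexive)
  open CommutativeRing commutativeRing public
    using (+-cong; +-congˡ; +-congʳ; +-assoc; +-comm; +-identityˡ; +-identityʳ; -‿inverseˡ; -‿inverseʳ;
           +-commutativeMonoid; +-group)
    renaming (refl to ≈-refl; sym to ≈-sym; trans to ≈-trans; reflexive to ≡⇒≈)
  open CommutativeMonoidSum +-commutativeMonoid public
    using (sum; sum-cong-≋; ∑-distrib-+)
  open MonoidMult (CommutativeRing.+-monoid commutativeRing) public
    using (×-homo-+) renaming (_×_ to _·_)
  open GroupProperties +-group public using (∙-cancelʳ)

  poset : Poset c ℓ₁ ℓ₂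
  poset = record { isPartialOrder = isPartialOrder }

  open PosetReasoning poset

  infixl 7 _⊓_
  infixl 6 _⊔_

  _⊓_ _⊔_ : Carrier → Carrier → Carrier
  x ⊓ y = if does (x ≤? y) then x else y
  x ⊔ y = if does (x ≤? y) then y else x

  private
    ≤-totalPreorder : TotalPreorder c ℓ₁ ℓ₂
    ≤-totalPreorder = record
      { isTotalPreorder = record
        { isPreorder = IsDecTotalOrder.isPreorder isDecTotalOrder ; total = total } }

    ⊓-operator : MinOperator ≤-totalPreorder
    ⊓-operator = record { _⊓_ = _⊓_ ; x≤y⇒x⊓y≈x = left ; x≥y⇒x⊓y≈y = right }
      where
      left : ∀ {x y} → x ≤ y → x ⊓ y ≈ x
      left {x} {y} x≤y with x ≤? y
      ... | yes _   = ≈-refl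
      ... | no  x≰y = contradiction x≤y x≰y
      right : ∀ {x y} → y ≤ x → x ⊓ y ≈ y
      right {x} {y} y≤x with x ≤? y
      ... | yes x≤y = antisym x≤y y≤x
      ... | no  _   = ≈-refl

    ⊔-operator : MaxOperator ≤-totalPreorder
    ⊔-operator = record { _⊔_ = _⊔_ ; x≤y⇒x⊔y≈y = right ; x≥y⇒x⊔y≈x = left }
      where
      right : ∀ {x y} → x ≤ y → x ⊔ y ≈ y
      right {x} {y} x≤y with x ≤? y
      ... | yes _   = ≈-refl
      ... | no  x≰y = contradiction x≤y x≰y
      left : ∀ {x y} → y ≤ x → x ⊔ y ≈ x
      left {x} {y} y≤x with x ≤? y
      ... | yes x≤y = antisym y≤x x≤y
      ... | no  _   = ≈-refl

  open MinOperator ⊓-operator public using (x≤y⇒x⊓y≈x; x≥y⇒x⊓y≈y)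
  open MaxOperator ⊔-operator public using (x≤y⇒x⊔y≈y; x≥y⇒x⊔y≈x)
  open MinMaxOp ⊓-operator ⊔-operator public
    using (x⊓y≤x; x⊓y≤y; x≤x⊔y; x≤y⊔x; ⊓-glb; ⊔-lub; ⊓-monoʳ-≤; ⊓-monoˡ-≤; ⊔-monoˡ-≤; ⊓-comm)

  ⊓+⊔ : ∀ x y → (x ⊓ y) + (x ⊔ y) ≈ x + y
  ⊓+⊔ x y with x ≤? y
  ... | yes _ = ≈-refl
  ... | no  _ = +-comm y x

  +-mono-≤ : ∀ {a b x y} → a ≤ b → x ≤ y → a + x ≤ b + y
  +-mono-≤ {a} {b} {x} {y} a≤b x≤y = begin
    a + x ≤⟨ +-monoʳ-≤ a x≤y ⟩
    a + y ≈⟨ +-comm a y ⟩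
    y + a ≤⟨ +-monoʳ-≤ y a≤b ⟩
    y + b ≈⟨ +-comm y b ⟩
    b + y ∎

  +-cancel-inverse : ∀ x z → (x + z) + - z ≈ x
  +-cancel-inverse x z = ≈-trans (+-assoc x z (- z)) (≈-trans (+-congˡ (-‿inverseʳ z)) (+-identityʳ x))

  -‿+-cancel : ∀ x y → (x - y) + y ≈ x
  -‿+-cancel x y = ≈-trans (+-assoc x (- y) y) (≈-trans (+-congˡ (-‿inverseˡ y)) (+-identityʳ x))

  +-cancelʳ-≤ : ∀ {x y} z → x + z ≤ y + z → x ≤ y
  +-cancelʳ-≤ {x} {y} z h = begin
    x               ≈⟨ +-cancel-inverse x z ⟨
    (x + z) + - z   ≤⟨ +-mono-≤ h ≤-refl ⟩
    (y + z) + - z   ≈⟨ +-cancel-inverse y z ⟩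
    y               ∎

  sum-mono-≤ : ∀ {n} {f g : Vector Carrier n} → (∀ i → f i ≤ g i) → sum f ≤ sum g
  sum-mono-≤ {zero}  h = ≤-refl
  sum-mono-≤ {suc n} h = +-mono-≤ (h zero) (sum-mono-≤ (h ∘ suc))

  sum-mono-≤-tight : ∀ {n} {f g : Vector Carrier n} →
    (∀ i → f i ≤ g i) → sum g ≤ sum f → ∀ i → g i ≤ f i
  sum-mono-≤-tight {suc n} {f} {g} h tight = λ where
      zero    → +-cancelʳ-≤ (sum (tail f)) (≤-trans (+-monoʳ-≤ (g zero) tail≤) tight)
      (suc i) → sum-mono-≤-tight (h ∘ suc) tail≥ i
    where
    tail≤ : sum (tail f) ≤ sum (tail g)
    tail≤ = sum-mono-≤ (h ∘ suc)
    tail≥ : sum (tail g) ≤ sum (tail f)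
    tail≥ = +-cancelʳ-≤ (f zero) (begin
      sum (tail g) + f zero  ≈⟨ +-comm _ _ ⟩
      f zero + sum (tail g)  ≤⟨ +-mono-≤ (h zero) ≤-refl ⟩
      sum g                  ≤⟨ tight ⟩
      sum f                  ≈⟨ +-comm _ _ ⟩
      sum (tail f) + f zero  ∎)

  sum-+ : ∀ {n} {f g h : Vector Carrier n} → (∀ i → f i + g i ≈ h i) → sum f + sum g ≈ sum h
  sum-+ {f = f} {g} eq = ≈-trans (≈-sym (∑-distrib-+ f g)) (sum-cong-≋ eq)

  sum-· : ∀ {n} (k : Vector ℕ n) θ → sum (λ i → k i · θ) ≈ sumℕ k · θ
  sum-· {zero}  k θ = ≈-refl
  sum-· {suc n} k θ = ≈-trans (+-congˡ (sum-· (tail k) θ)) (≈-sym (×-homo-+ θ (head k) (sumℕ (tail k))))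

0ᵛ : ∀ {n} → Vector ℕ n
0ᵛ _ = 0

-- Duality and thresholds for buying the cheapest elements.

module Thresholds {c ℓ₁ ℓ₂} (F : OrderedField c ℓ₁ ℓ₂) where
  open OrderedField F
  open OrderedFieldProperties F
  open Regret F using (_ᵀ_)
  open PosetReasoning poset

  -- For binary x and θ, capped x v θ ≤ v ᵀ y + excess θ is weak linear
  -- programming duality for the choice of the cheapest y ∈ Recourse p x.
  capped : ∀ {n} → Vector ℕ n → Vector Carrier n → Carrier → Carrier
  capped x v θ = sum λ i → (1 ∸ x i) · (θ ⊓ v i)

  excess : ℕ → ℕ → Carrier → Carrier
  excess n p θ = sum λ i → slack {n} p i · θ

  -- Complementary slackness for the dual value `θ`. When `y` is a recourse for `x`, the elements of
  -- `x` are constrained by neither clause.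
  Threshold : ∀ {n} → Vector ℕ n → Vector ℕ n → Vector Carrier n → Carrier → Set _
  Threshold x y v θ = ∀ i → (y i ≡ 1 → v i ≤ θ) × (x i ℕ.+ y i ≡ 0 → θ ≤ v i)

  data Disjoint : ℕ → ℕ → Set where
    neither : Disjoint 0 0
    first   : Disjoint 1 0
    second  : Disjoint 0 1

  disjoint : ∀ a b → a ℕ.+ b ℕ.≤ 1 → Disjoint a b
  disjoint 0 0 _ = neither
  disjoint 1 0 _ = first
  disjoint 0 1 _ = second
  disjoint 0 (suc (suc _)) (s≤s ())
  disjoint 1 (suc _) (s≤s ())
  disjoint (suc (suc _)) _ (s≤s ())

  module _ {n p} {x y : Vector ℕ n} (p≤n : p ℕ.≤ n) (y∈R : y ∈ Recourse p x)
           (v : Vector Carrier n) (θ : Carrier) where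

    private
      -- The primal side of the duality, with the excess charged to the elements in neither `x` nor
      -- `y`. There are n - p of them, so the sum is right, and the comparison with `capped` can be
      -- made one element at a time.
      bound : Vector Carrier n
      bound i = y i · v i + (1 ∸ (x i ℕ.+ y i)) · θ

      disj : ∀ i → Disjoint (x i) (y i)
      disj i = disjoint (x i) (y i) (proj₁ (proj₂ y∈R) i)

    unselected≡slack : sumℕ (λ i → 1 ∸ (x i ℕ.+ y i)) ≡ sumℕ {n} (slack p)
    unselected≡slack = ≡.trans
      (ℕ.+-cancelʳ-≡ p _ _ (≡.trans
        (≡.cong (sumℕ (λ i → 1 ∸ (x i ℕ.+ y i)) ℕ.+_) (≡.sym (proj₂ (proj₂ y∈R))))
        (≡.trans (sumℕ-complement (x +ᵛ y) (proj₁ (proj₂ y∈R))) (≡.sym (ℕ.m∸n+n≡m p≤n)))))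
      (≡.sym (sumℕ-slack p p≤n))

    unselected-excess : sum (λ i → (1 ∸ (x i ℕ.+ y i)) · θ) ≈ excess n p θ
    unselected-excess = ≈-trans (sum-· {n} _ θ)
      (≈-trans (≡⇒≈ (≡.cong (_· θ) unselected≡slack)) (≈-sym (sum-· {n} (slack p) θ)))

    private
      bound-sum : sum bound ≈ v ᵀ y + excess n p θ
      bound-sum = ≈-trans (∑-distrib-+ (λ i → y i · v i) _) (+-congˡ unselected-excess)

      capped≤bound : ∀ i → (1 ∸ x i) · (θ ⊓ v i) ≤ bound i
      capped≤bound i = go (disj i)
        where
        go : ∀ {a b} → Disjoint a b → (1 ∸ a) · (θ ⊓ v i) ≤ b · v i + (1 ∸ (a ℕ.+ b)) · θ
        go neither = begin
          θ ⊓ v i + 0#     ≤⟨ +-mono-≤ (x⊓y≤x θ (v i)) ≤-refl ⟩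
          θ + 0#           ≈⟨ +-identityˡ _ ⟨
          0# + (θ + 0#)    ∎
        go first   = ≤-reflexive (≈-sym (+-identityˡ 0#))
        go second  = begin
          θ ⊓ v i + 0#     ≤⟨ +-mono-≤ (x⊓y≤y θ (v i)) ≤-refl ⟩
          v i + 0#         ≈⟨ +-identityʳ _ ⟨
          v i + 0# + 0#    ∎

    capped≤ : capped x v θ ≤ v ᵀ y + excess n p θ
    capped≤ = ≤-respʳ-≈ bound-sum (sum-mono-≤ capped≤bound)

    capped≥ : Threshold x y v θ → v ᵀ y + excess n p θ ≤ capped x v θ
    capped≥ thr = ≤-respˡ-≈ bound-sum (sum-mono-≤ (λ i → go i (disj i) (thr i)))
      where
      go : ∀ i {a b} → Disjoint a b → (b ≡ 1 → v i ≤ θ) × (a ℕ.+ b ≡ 0 → θ ≤ v i) →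
           b · v i + (1 ∸ (a ℕ.+ b)) · θ ≤ (1 ∸ a) · (θ ⊓ v i)
      go i neither (_ , above) = begin
        0# + (θ + 0#)    ≈⟨ +-identityˡ _ ⟩
        θ + 0#           ≤⟨ +-mono-≤ (⊓-glb ≤-refl (above refl)) ≤-refl ⟩
        θ ⊓ v i + 0#     ∎
      go i first   _           = ≤-reflexive (+-identityˡ 0#)
      go i second  (below , _) = begin
        v i + 0# + 0#    ≈⟨ +-identityʳ _ ⟩
        v i + 0#         ≤⟨ +-mono-≤ (⊓-glb (below refl) ≤-refl) ≤-refl ⟩
        θ ⊓ v i + 0#     ∎

    capped≈ : Threshold x y v θ → capped x v θ ≈ v ᵀ y + excess n p θ
    capped≈ thr = antisym capped≤ (capped≥ thr)

    -- Equality of the sums forces equality in every summand, which is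
    -- complementary slackness.
    tight⇒threshold : v ᵀ y + excess n p θ ≤ capped x v θ → Threshold x y v θ
    tight⇒threshold tight i = go (disj i)
      (sum-mono-≤-tight capped≤bound (≤-respˡ-≈ (≈-sym bound-sum) tight) i)
      where
      go : ∀ {a b} → Disjoint a b →
           b · v i + (1 ∸ (a ℕ.+ b)) · θ ≤ (1 ∸ a) · (θ ⊓ v i) →
           (b ≡ 1 → v i ≤ θ) × (a ℕ.+ b ≡ 0 → θ ≤ v i)
      go neither h = (λ ()) , λ _ → begin
        θ              ≈⟨ ≈-trans (+-identityˡ _) (+-identityʳ _) ⟨
        0# + (θ + 0#)  ≤⟨ h ⟩
        θ ⊓ v i + 0#   ≈⟨ +-identityʳ _ ⟩
        θ ⊓ v i        ≤⟨ x⊓y≤y θ (v i) ⟩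
        v i            ∎
      go first  h = (λ ()) , λ ()
      go second h = (λ _ → begin
        v i            ≈⟨ ≈-trans (+-identityʳ _) (+-identityʳ _) ⟨
        v i + 0# + 0#  ≤⟨ h ⟩
        θ ⊓ v i + 0#   ≈⟨ +-identityʳ _ ⟩
        θ ⊓ v i        ≤⟨ x⊓y≤x θ (v i) ⟩
        θ              ∎) , λ ()

  -- Weak duality for `z` meets equality for `y` at the same `θ`; the excess does not depend on the
  -- selection and cancels.
  threshold-minimal : ∀ {n p} {x y z : Vector ℕ n} → p ℕ.≤ n → y ∈ Recourse p x →
    ∀ {v θ} → Threshold x y v θ → z ∈ Recourse p x → v ᵀ y ≤ v ᵀ z
  threshold-minimal p≤n y∈R {v} {θ} thr z∈R =
    +-cancelʳ-≤ _ (≤-trans (capped≥ p≤n y∈R v θ thr) (capped≤ p≤n z∈R v θ))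

  -- Only the order of the prices matters. This is how one threshold for `l` serves `l i ⊔ α` for
  -- every `α`, and one for `u` serves `u i ⊓ α`.
  threshold-map : ∀ {n} {x y : Vector ℕ n} {v θ} {f : Carrier → Carrier} →
    (∀ {a b} → a ≤ b → f a ≤ f b) → Threshold x y v θ → Threshold x y (f ∘ v) (f θ)
  threshold-map mono thr i = mono ∘ proj₁ (thr i) , mono ∘ proj₂ (thr i)

  threshold-resp : ∀ {n} {x y : Vector ℕ n} {v w θ} → (∀ i → v i ≈ w i) →
    Threshold x y v θ → Threshold x y w θ
  threshold-resp v≈w thr i =
    ≤-respˡ-≈ (v≈w i) ∘ proj₁ (thr i) , ≤-respʳ-≈ (v≈w i) ∘ proj₂ (thr i)

  -- The finitely many thresholds that a program can try. The value `0#` serves the empty recourse,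
  -- as all prices are nonnegative.
  FromValues : ∀ {n} → Vector Carrier n → Carrier → Set _
  FromValues v θ = θ ≡ 0# ⊎ ∃[ j ] θ ≡ v j

  argmin : ∀ {n} (z : Vector ℕ n) → Binary z → (v : Vector Carrier n) →
    (∀ i → z i ≡ 1) ⊎ (∃[ j ] z j ≡ 0 × (∀ i → z i ≡ 0 → v j ≤ v i))
  argmin {zero}  z bin v = inj₁ λ ()
  argmin {suc n} z bin v with z zero in eq | bin zero | argmin (tail z) (bin ∘ suc) (tail v)
  ... | 1 | _ | inj₁ ones = inj₁ λ { zero → eq ; (suc i) → ones i }
  ... | 1 | _ | inj₂ (j , zj≡0 , min) = inj₂ (suc j , zj≡0 , λ where
    zero    z0≡0 → contradiction (≡.trans (≡.sym eq) z0≡0) λ ()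
    (suc i) → min i)
  ... | 0 | _ | inj₁ ones = inj₂ (zero , eq , λ where
    zero    _    → ≤-refl
    (suc i) zi≡0 → contradiction (≡.trans (≡.sym (ones i)) zi≡0) λ ())
  ... | 0 | _ | inj₂ (j , zj≡0 , min) with total (v zero) (v (suc j))
  ...   | inj₁ v0≤vj = inj₂ (zero , eq , λ where
    zero    _    → ≤-refl
    (suc i) zi≡0 → ≤-trans v0≤vj (min i zi≡0))
  ...   | inj₂ vj≤v0 = inj₂ (suc j , zj≡0 , λ where
    zero    _ → vj≤v0
    (suc i) → min i)
  argmin {suc n} z bin v | suc (suc _) | s≤s () | _

  private
    -- Elements are bought one at a time, cheapest first, so the price of the last purchase is a
    -- threshold.
    greedy : ∀ {n} (x : Vector ℕ n) → Binary x → (v : Vector Carrier n) → (∀ i → 0# ≤ v i) →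
      ∀ k → sumℕ x ℕ.+ k ℕ.≤ n →
      ∃[ y ] Binary (x +ᵛ y) × sumℕ (x +ᵛ y) ≡ sumℕ x ℕ.+ k ×
        ∃[ θ ] FromValues v θ × Threshold x y v θ
    greedy {n} x bin v 0≤v zero _ = 0ᵛ
      , (λ i → ≡.subst (ℕ._≤ 1) (≡.sym (ℕ.+-identityʳ (x i))) (bin i))
      , ≡.trans (ℕΣ.sum-cong-≗ (λ i → ℕ.+-identityʳ (x i))) (≡.sym (ℕ.+-identityʳ _))
      , 0# , inj₁ refl , λ i → (λ ()) , λ _ → 0≤v i
    greedy {n} x bin v 0≤v (suc k) le
      with greedy x bin v 0≤v k (ℕ.≤-trans (ℕ.+-monoʳ-≤ (sumℕ x) (ℕ.n≤1+n k)) le)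
    ... | y , bin′ , sum≡ , θ , _ , thr with argmin (x +ᵛ y) bin′ v
    ...   | inj₁ ones = contradiction
      (≡.subst₂ ℕ._≤_ (≡.trans (ℕ.+-suc (sumℕ x) k) (≡.cong suc (≡.sym sum≡))) (≡.sym (sumℕ-ones _ ones)) le)
      (ℕ.<-irrefl refl)
    ...   | inj₂ (j , zj≡0 , min) = y′ , bin″
      , ≡.trans (≡.trans (ℕΣ.sum-cong-≗ x+y′) (sumℕ-updateAt-suc (x +ᵛ y) j))
          (≡.trans (≡.cong suc sum≡) (≡.sym (ℕ.+-suc (sumℕ x) k)))
      , v j , inj₂ (j , refl) , thr′
      where
      y′ : Vector ℕ n
      y′ = updateAt y j suc
      x+y′ : ∀ i → x i ℕ.+ y′ i ≡ updateAt (x +ᵛ y) j suc i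
      x+y′ i with i Fin.≟ j
      ... | yes refl = ≡.trans (≡.cong (x i ℕ.+_) (updateAt-updates i y))
        (≡.trans (ℕ.+-suc (x i) (y i)) (≡.sym (updateAt-updates i (x +ᵛ y))))
      ... | no i≢j = ≡.trans (≡.cong (x i ℕ.+_) (updateAt-minimal i j y i≢j))
        (≡.sym (updateAt-minimal i j (x +ᵛ y) i≢j))
      bin″ : Binary (x +ᵛ y′)
      bin″ i with i Fin.≟ j
      ... | yes refl = ℕ.≤-reflexive (≡.trans (x+y′ i)
        (≡.trans (updateAt-updates i (x +ᵛ y)) (≡.cong suc zj≡0)))
      ... | no i≢j = ≡.subst (ℕ._≤ 1)
        (≡.sym (≡.trans (x+y′ i) (updateAt-minimal i j (x +ᵛ y) i≢j))) (bin′ i)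
      thr′ : Threshold x y′ v (v j)
      thr′ i with i Fin.≟ j
      ... | yes refl = (λ _ → ≤-refl) , λ _ → ≤-refl
      ... | no i≢j =
          -- An earlier purchase costs at most the old threshold `θ`, and `j`, still untaken at that
          -- point, costs at least `θ`.
          (λ y′i≡1 → ≤-trans (proj₁ (thr i) (≡.trans (≡.sym (updateAt-minimal i j y i≢j)) y′i≡1))
                       (proj₂ (thr j) zj≡0))
        , (λ zi≡0 → min i (≡.trans (≡.cong (x i ℕ.+_) (≡.sym (updateAt-minimal i j y i≢j))) zi≡0))

  cheapest : ∀ {n p} (x : Vector ℕ n) → Binary x → sumℕ x ℕ.≤ p → p ℕ.≤ n →
    (v : Vector Carrier n) → (∀ i → 0# ≤ v i) →
    ∃[ y ] y ∈ Recourse p x × ∃[ θ ] FromValues v θ × Threshold x y v θ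
  cheapest {n} {p} x bin x≤p p≤n v 0≤v
    with greedy x bin v 0≤v (p ∸ sumℕ x) (≡.subst (ℕ._≤ n) (≡.sym (ℕ.m+[n∸m]≡n x≤p)) p≤n)
  ... | y , bin′ , sum≡ , θ , from , thr =
    y , ((λ i → ℕ.≤-trans (ℕ.m≤n+m (y i) (x i)) (bin′ i)) , bin′ , ≡.trans sum≡ (ℕ.m+[n∸m]≡n x≤p))
      , θ , from , thr

-- Summands shared by the program and the proof.

module Formula {c ℓ₁ ℓ₂} (F : OrderedField c ℓ₁ ℓ₂) where
  open OrderedField F
  open OrderedFieldProperties F

  lowerPrice : (C lo : Carrier) → Carrier
  lowerPrice C lo = C ⊓ lo

  upperPrice : ℕ → (C lo up : Carrier) → Carrier
  upperPrice ξ C lo up = if 1 ≤ᵇ ξ then lowerPrice C lo else C ⊓ up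

  dualTerm : Bool → (θ v : Carrier) → Carrier
  dualTerm e θ v = (θ ⊓ v) - (if e then θ else 0#)

  -- l and u are the lower and upper price of the element.
  regretTerm : Bool → ℕ → (C up l u θl θu α : Carrier) → Carrier
  regretTerm e ξ C up l u θl θu α =
    (if e then base + a + b else base) - (if e then q + α + α else q)
    where
    a = θl ⊔ α
    b = θu ⊓ α
    base = (if 1 ≤ᵇ ξ then C else α ⊓ up) + α
    q = (a ⊓ (l ⊔ α)) + (b ⊓ (u ⊓ α))

-- Regroupings in the additive monoid.

module Rearrangement {c ℓ₁ ℓ₂} (F : OrderedField c ℓ₁ ℓ₂) where
  open OrderedField F
  open OrderedFieldProperties F
  open CommutativeMonoidSolver +-commutativeMonoid using (solve; _⊜_; id) renaming (_⊕_ to infixl 6 _⊹_)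

  over-neg : ∀ q r s → (q + 0#) + (r + 0#) + (s + 0#) + (s + 0#) ≈ q + r + s + s
  over-neg = solve 3 (λ q r s → (q ⊹ id) ⊹ (r ⊹ id) ⊹ (s ⊹ id) ⊹ (s ⊹ id) ⊜ q ⊹ r ⊹ s ⊹ s) ≈-refl

  over-pos : ∀ q r s → q + r + s ≈ q + (r + 0#) + (s + 0#)
  over-pos = solve 3 (λ q r s → q ⊹ r ⊹ s ⊜ q ⊹ (r ⊹ id) ⊹ (s ⊹ id)) ≈-refl

  under-neg : ∀ q r → (q + 0#) + (r + 0#) + 0# + 0# ≈ q + r
  under-neg = solve 2 (λ q r → (q ⊹ id) ⊹ (r ⊹ id) ⊹ id ⊹ id ⊜ q ⊹ r) ≈-refl

  under-pos : ∀ q → q ≈ q + 0# + 0#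
  under-pos = solve 1 (λ q → q ⊜ q ⊹ id ⊹ id) ≈-refl

  value₁ : ∀ r w c e f g → (r + (w + e)) + (c + e + f + g) ≈ r + ((w + c) + f + g + e + e)
  value₁ = solve 6 (λ r w c e f g → (r ⊹ (w ⊹ e)) ⊹ (c ⊹ e ⊹ f ⊹ g) ⊜ r ⊹ ((w ⊹ c) ⊹ f ⊹ g ⊹ e ⊹ e)) ≈-refl

  value₂ : ∀ q r e f → (q + r) + e + f ≈ (r + e) + (q + f)
  value₂ = solve 4 (λ q r e f → (q ⊹ r) ⊹ e ⊹ f ⊜ (r ⊹ e) ⊹ (q ⊹ f)) ≈-refl

  value₃ : ∀ s c e f g → s + (c + e) + f + g ≈ s + (c + e + f + g)
  value₃ = solve 5 (λ s c e f g → s ⊹ (c ⊹ e) ⊹ f ⊹ g ⊜ s ⊹ (c ⊹ e ⊹ f ⊹ g)) ≈-refl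

  upper₁ : ∀ c m a b d e k w z →
    (c + m) + (a + b + d + e + k + w + z) ≈ c + ((m + (a + b)) + ((d + e) + ((k + w) + z)))
  upper₁ = solve 9 (λ c m a b d e k w z → (c ⊹ m) ⊹ (a ⊹ b ⊹ d ⊹ e ⊹ k ⊹ w ⊹ z)
    ⊜ c ⊹ ((m ⊹ (a ⊹ b)) ⊹ ((d ⊹ e) ⊹ ((k ⊹ w) ⊹ z)))) ≈-refl

  upper₂ : ∀ c a d f k q g b w →
    c + ((a + (d + f)) + (k + ((q + (g + b)) + w))) ≈ (c + q) + ((g + f) + (a + b + d + k + w))
  upper₂ = solve 9 (λ c a d f k q g b w → c ⊹ ((a ⊹ (d ⊹ f)) ⊹ (k ⊹ ((q ⊹ (g ⊹ b)) ⊹ w)))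
    ⊜ (c ⊹ q) ⊹ ((g ⊹ f) ⊹ (a ⊹ b ⊹ d ⊹ k ⊹ w))) ≈-refl

  upper₃ : ∀ r z e o a b d k w →
    (r + (z + e)) + (o + (a + b + d + k + w)) ≈ (r + o) + (a + b + d + e + k + w + z)
  upper₃ = solve 9 (λ r z e o a b d k w → (r ⊹ (z ⊹ e)) ⊹ (o ⊹ (a ⊹ b ⊹ d ⊹ k ⊹ w))
    ⊜ (r ⊹ o) ⊹ (a ⊹ b ⊹ d ⊹ e ⊹ k ⊹ w ⊹ z)) ≈-refl

  attained₁ : ∀ r o w e → (r + o) + (w + e) ≈ (r + (w + e)) + o
  attained₁ = solve 4 (λ r o w e → (r ⊹ o) ⊹ (w ⊹ e) ⊜ (r ⊹ (w ⊹ e)) ⊹ o) ≈-refl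

  attained₂ : ∀ c w e z → c + ((w + e) + z) ≈ (c + w) + (z + e)
  attained₂ = solve 4 (λ c w e z → c ⊹ ((w ⊹ e) ⊹ z) ⊜ (c ⊹ w) ⊹ (z ⊹ e)) ≈-refl

-- Prices for the adversary and the dual sum for p elements.

module MaximumRegret {c ℓ₁ ℓ₂} (F : OrderedField c ℓ₁ ℓ₂) {n} (I : Regret.Instance F n)
                     (x : Vector ℕ n) (x∈ : x ∈ FirstStage (Regret.Instance.p I)) where
  open OrderedField F
  open OrderedFieldProperties F
  open Regret F hiding (Instance)
  open Regret.Instance I
  open Thresholds F
  open Formula F
  open CommutativeMonoidMult +-commutativeMonoid using (×-distrib-+; ×-congʳ)
  open Rearrangement F
  open PosetReasoning poset

  -- On `x` the recourse cannot use `i`, so a low cost there loses nothing in the capped sum: the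
  -- second-stage price is `lower i` whatever `α` is, and the two bounds on the price coincide.
  l u : Vector Carrier n
  l i = lowerPrice (C i) (lower i)
  u i = upperPrice (x i) (C i) (lower i) (upper i)

  l≤u : ∀ i → l i ≤ u i
  l≤u i with x i
  ... | 0     = ⊓-monoʳ-≤ (C i) (lower≤upper i)
  ... | suc _ = ≤-refl

  0≤l : ∀ i → 0# ≤ l i
  0≤l i = ⊓-glb (0≤C i) (0≤lower i)

  0≤u : ∀ i → 0# ≤ u i
  0≤u i = ≤-trans (0≤l i) (l≤u i)

  over : Fin n → Bool
  over i = p ≤ᵇ toℕ i

  dual : Vector Carrier n → Carrier → Carrier
  dual v θ = sum λ i → dualTerm (over i) θ (v i)

  -- The flag in `dualTerm` is true at exactly the positions counted by `slack`. Hence `dual v` is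
  -- the dual objective for buying p elements from scratch.
  dual+excess : ∀ v θ → dual v θ + excess n p θ ≈ capped 0ᵛ v θ
  dual+excess v θ = sum-+ pointwise
    where
    pointwise : ∀ i → dualTerm (over i) θ (v i) + slack p i · θ ≈ 1 · (θ ⊓ v i)
    pointwise i with over i
    ... | true  = ≈-trans (+-congˡ (+-identityʳ θ)) (≈-trans (-‿+-cancel _ θ) (≈-sym (+-identityʳ _)))
    ... | false = ≈-trans (-‿+-cancel _ 0#) (≈-sym (+-identityʳ _))

  p-cheapest : ∀ v → (∀ i → 0# ≤ v i) →
    ∃[ y ] y ∈ Recourse p 0ᵛ × ∃[ θ ] FromValues v θ × Threshold 0ᵛ y v θ
  p-cheapest = cheapest 0ᵛ (λ _ → z≤n) (ℕ.≤-trans (ℕ.≤-reflexive (sum0 n)) z≤n) p≤n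
    where
    sum0 : ∀ n → sumℕ {n} 0ᵛ ≡ 0
    sum0 zero    = refl
    sum0 (suc n) = sum0 n

  -- Some candidate attains the primal optimum, so `θ*` attains at least as much. Weak duality is
  -- then tight at `θ*`, and complementary slackness makes it a threshold.
  dual-maximiser : ∀ v → (∀ i → 0# ≤ v i) → ∀ θ* →
    (∀ {θ} → FromValues v θ → dual v θ ≤ dual v θ*) →
    ∃[ y ] y ∈ Recourse p 0ᵛ × Threshold 0ᵛ y v θ*
  dual-maximiser v 0≤v θ* max with p-cheapest v 0≤v
  ... | y , y∈R , θ , from , thr = y , y∈R , tight⇒threshold p≤n y∈R v θ* (begin
    v ᵀ y + excess n p θ*     ≈⟨ +-congʳ value ⟨
    dual v θ + excess n p θ*  ≤⟨ +-mono-≤ (max from) ≤-refl ⟩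
    dual v θ* + excess n p θ* ≈⟨ dual+excess v θ* ⟩
    capped 0ᵛ v θ*            ∎)
    where
    value : dual v θ ≈ v ᵀ y
    value = ∙-cancelʳ (excess n p θ) _ _
      (≈-trans (dual+excess v θ) (capped≈ p≤n y∈R v θ thr))

  -- What buying i in the second stage costs the adversary given α: lower i plus
  -- the loss in the capped sum when s i drops from upper i to lower i.
  secondPrice : Carrier → Vector Carrier n
  secondPrice α i = if 1 ≤ᵇ x i then lower i else lower i ⊔ (upper i ⊓ α)

  -- What the adversary pays for `i` in the better stage, `C i ⊓ secondPrice α i`, written as `α`
  -- clamped between `l i` and `u i`. The lemmas `price≤C`, `price≤secondPrice` and
  -- `C⊓secondPrice≤price` justify this form.
  price : Carrier → Vector Carrier n
  price α i = l i ⊔ (u i ⊓ α)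

  price-⊔ : ∀ α i → price α i ⊔ α ≈ l i ⊔ α
  price-⊔ α i = antisym
    (⊔-lub (⊔-lub (x≤x⊔y _ _) (≤-trans (x⊓y≤y _ _) (x≤y⊔x _ _))) (x≤y⊔x _ _))
    (⊔-monoˡ-≤ α (x≤x⊔y _ _))

  price-⊓ : ∀ α i → price α i ⊓ α ≈ u i ⊓ α
  price-⊓ α i = antisym
    (⊓-monoˡ-≤ α (⊔-lub (l≤u i) (x⊓y≤x _ _)))
    (⊓-glb (x≤y⊔x _ _) (x⊓y≤y _ _))

  0≤price : ∀ α i → 0# ≤ price α i
  0≤price α i = ≤-trans (0≤l i) (x≤x⊔y _ _)

  price≤C : ∀ α i → price α i ≤ C i
  price≤C α i = ⊔-lub (x⊓y≤x _ _) (≤-trans (x⊓y≤x _ _) u≤C)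
    where
    u≤C : u i ≤ C i
    u≤C with x i
    ... | 0     = x⊓y≤x _ _
    ... | suc _ = x⊓y≤x _ _

  price≤secondPrice : ∀ α i → price α i ≤ secondPrice α i
  price≤secondPrice α i with x i
  ... | 0     = ⊔-lub (≤-trans (x⊓y≤y _ _) (x≤x⊔y _ _)) (≤-trans (⊓-monoˡ-≤ α (x⊓y≤y _ _)) (x≤y⊔x _ _))
  ... | suc _ = ⊔-lub (x⊓y≤y _ _) (≤-trans (x⊓y≤x _ _) (x⊓y≤y _ _))

  C⊓secondPrice≤price : ∀ α i → C i ⊓ secondPrice α i ≤ price α i
  C⊓secondPrice≤price α i with x i
  ... | suc _ = x≤x⊔y _ _
  ... | 0 with total (lower i) (upper i ⊓ α)
  ...   | inj₂ h = ≤-trans (⊓-monoʳ-≤ (C i) (≤-reflexive (x≥y⇒x⊔y≈x h))) (x≤x⊔y _ _)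
  ...   | inj₁ h = ≤-trans
    (⊓-glb (⊓-glb (x⊓y≤x _ _) (≤-trans C⊓≤ (x⊓y≤x _ _))) (≤-trans C⊓≤ (x⊓y≤y _ _))) (x≤y⊔x _ _)
    where
    C⊓≤ : C i ⊓ (lower i ⊔ (upper i ⊓ α)) ≤ upper i ⊓ α
    C⊓≤ = ≤-trans (x⊓y≤y _ _) (≤-reflexive (x≤y⇒x⊔y≈y h))

  -- Justifies `secondPrice` off `x`. As `lower i ≤ upper i`, the first term is the minimum of
  -- `lower i` and `upper i ⊓ α`, of which the second is the maximum.
  second-exchange : ∀ α i → (α ⊓ lower i) + (lower i ⊔ (upper i ⊓ α)) ≈ (α ⊓ upper i) + lower i
  second-exchange α i = ≈-trans (+-congʳ α⊓lo) (≈-trans (⊓+⊔ (lower i) (upper i ⊓ α))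
    (≈-trans (+-comm _ _) (+-congʳ (⊓-comm _ _))))
    where
    α⊓lo : α ⊓ lower i ≈ lower i ⊓ (upper i ⊓ α)
    α⊓lo = antisym
      (⊓-glb (x⊓y≤y _ _) (⊓-glb (≤-trans (x⊓y≤y _ _) (lower≤upper i)) (x⊓y≤x _ _)))
      (⊓-glb (≤-trans (x⊓y≤y _ _) (x⊓y≤y _ _)) (x⊓y≤x _ _))

  -- The worst scenario against an adversary who buys y in the second stage.
  extreme : Vector ℕ n → Vector Carrier n
  extreme y i = if 1 ≤ᵇ y i then lower i else upper i

  extreme∈Scenario : ∀ y → extreme y ∈ Scenario I
  extreme∈Scenario y i with y i
  ... | 0     = lower≤upper i , ≤-refl
  ... | suc _ = ≤-refl , lower≤upper i

  -- Existence of Inc and Opt, and change of scenario.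

  x-binary : Binary x
  x-binary = proj₁ x∈

  sumx≤p : sumℕ x ℕ.≤ p
  sumx≤p with proj₂ x∈
  ... | y , _ , _ , sum≡ = ℕ.≤-trans (ℕ.m≤m+n (sumℕ x) (sumℕ y))
    (ℕ.≤-reflexive (≡.trans (≡.sym (ℕΣ.∑-distrib-+ x y)) sum≡))

  0≤scenario : ∀ {s} → s ∈ Scenario I → ∀ i → 0# ≤ s i
  0≤scenario s∈U i = ≤-trans (0≤lower i) (proj₁ (s∈U i))

  x-cheapest : ∀ {s} → s ∈ Scenario I →
    ∃[ y ] y ∈ Recourse p x × ∃[ θ ] FromValues s θ × Threshold x y s θ
  x-cheapest {s} s∈U = cheapest x x-binary sumx≤p p≤n s (0≤scenario s∈U)

  inc-exists : ∀ {s} → s ∈ Scenario I → ∃[ inc ] IsInc I x s inc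
  inc-exists {s} s∈U with x-cheapest s∈U
  ... | y , y∈R , θ , _ , thr = C ᵀ x + s ᵀ y , s ᵀ y ,
    ((y , y∈R , ≈-refl) , λ { (z , z∈R , eq) →
      ≤-respʳ-≈ (≈-sym eq) (threshold-minimal p≤n y∈R thr z∈R) }) , ≈-refl

  -- Each element of `z` goes to the stage where it is cheaper, `κ` being the second-stage price.
  -- The test is the one inside `_⊓_`, so one case split evaluates the minimum as well.
  firstPart secondPart : Vector Carrier n → Vector ℕ n → Vector ℕ n
  firstPart  κ z i = if does (C i ≤? κ i) then z i else 0
  secondPart κ z i = if does (C i ≤? κ i) then 0 else z i

  parts-sum : ∀ κ z i → firstPart κ z i ℕ.+ secondPart κ z i ≡ z i
  parts-sum κ z i with does (C i ≤? κ i)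
  ... | true  = ℕ.+-identityʳ (z i)
  ... | false = refl

  parts∈TwoStage : ∀ κ {z} → z ∈ Recourse p 0ᵛ → (firstPart κ z , secondPart κ z) ∈ TwoStage p
  parts∈TwoStage κ {z} (bin , _ , sum≡) = (first-bin , _ , second∈) , second∈
    where
    first-bin : Binary (firstPart κ z)
    first-bin i = ℕ.≤-trans (ℕ.m≤m+n _ _) (ℕ.≤-trans (ℕ.≤-reflexive (parts-sum κ z i)) (bin i))
    second∈ : secondPart κ z ∈ Recourse p (firstPart κ z)
    second∈ = (λ i → ℕ.≤-trans (ℕ.m≤n+m _ _) (ℕ.≤-trans (ℕ.≤-reflexive (parts-sum κ z i)) (bin i)))
      , (λ i → ℕ.≤-trans (ℕ.≤-reflexive (parts-sum κ z i)) (bin i))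
      , ≡.trans (ℕΣ.sum-cong-≗ (parts-sum κ z)) sum≡

  total∈Recourse : ∀ {x′ y′ : Vector ℕ n} → (x′ , y′) ∈ TwoStage p → (x′ +ᵛ y′) ∈ Recourse p 0ᵛ
  total∈Recourse (_ , _ , bin , sum≡) = bin , bin , sum≡

  ᵀ-+ᵛ : ∀ (v : Vector Carrier n) x′ y′ → v ᵀ (x′ +ᵛ y′) ≈ v ᵀ x′ + v ᵀ y′
  ᵀ-+ᵛ v x′ y′ = ≈-trans (sum-cong-≋ (λ i → ×-homo-+ (v i) (x′ i) (y′ i)))
    (∑-distrib-+ (λ i → x′ i · v i) (λ i → y′ i · v i))

  ·-monoʳ-≤ : ∀ k {a b} → a ≤ b → k · a ≤ k · b
  ·-monoʳ-≤ zero    a≤b = ≤-refl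
  ·-monoʳ-≤ (suc k) a≤b = +-mono-≤ a≤b (·-monoʳ-≤ k a≤b)

  -- Every two-stage solution pays at least `C i ⊓ s i` for each of its p elements, and the split of
  -- the p cheapest elements pays exactly that.
  opt-exists : ∀ {s} → s ∈ Scenario I → ∃[ opt ] IsOpt I s opt
  opt-exists {s} s∈U with p-cheapest (λ i → C i ⊓ s i) (λ i → ⊓-glb (0≤C i) (0≤scenario s∈U i))
  ... | z , z∈R , θ , _ , thr = _ , (_ , _ , parts∈TwoStage s z∈R , ≈-refl) , λ where
      (x′ , y′ , xy∈Z , eq) → ≤-respʳ-≈ (≈-sym eq) (begin
        C ᵀ firstPart s z + s ᵀ secondPart s z ≈⟨ sum-+ pointwise ⟩
        v ᵀ z                 ≤⟨ threshold-minimal p≤n z∈R thr (total∈Recourse xy∈Z) ⟩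
        v ᵀ (x′ +ᵛ y′)        ≈⟨ ᵀ-+ᵛ v x′ y′ ⟩
        v ᵀ x′ + v ᵀ y′       ≤⟨ +-mono-≤ (sum-mono-≤ (λ i → ·-monoʳ-≤ (x′ i) (x⊓y≤x _ _)))
                                          (sum-mono-≤ (λ i → ·-monoʳ-≤ (y′ i) (x⊓y≤y _ _))) ⟩
        C ᵀ x′ + s ᵀ y′       ∎)
    where
    v : Vector Carrier n
    v i = C i ⊓ s i
    pointwise : ∀ i → firstPart s z i · C i + secondPart s z i · s i ≈ z i · v i
    pointwise i with does (C i ≤? s i)
    ... | true  = +-identityʳ _
    ... | false = +-identityˡ _

  -- Raising s towards extreme y′ gains most on y″ and loses most on y′.
  scenario-exchange : ∀ {s} → s ∈ Scenario I → ∀ {y′ y″ : Vector ℕ n} → Binary y′ → Binary y″ →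
    s ᵀ y″ + extreme y′ ᵀ y′ ≤ extreme y′ ᵀ y″ + s ᵀ y′
  scenario-exchange {s} s∈U {y′} {y″} bin′ bin″ = begin
    s ᵀ y″ + extreme y′ ᵀ y′  ≈⟨ ∑-distrib-+ (λ i → y″ i · s i) _ ⟨
    sum (λ i → y″ i · s i + y′ i · extreme y′ i)  ≤⟨ sum-mono-≤ pointwise ⟩
    sum (λ i → y″ i · extreme y′ i + y′ i · s i)  ≈⟨ ∑-distrib-+ (λ i → y″ i · extreme y′ i) _ ⟩
    extreme y′ ᵀ y″ + s ᵀ y′  ∎
    where
    pointwise : ∀ i → y″ i · s i + y′ i · extreme y′ i ≤ y″ i · extreme y′ i + y′ i · s i
    pointwise i with y′ i | y″ i | bin′ i | bin″ i
    ... | 0 | k | _ | _ = +-mono-≤ (·-monoʳ-≤ k (proj₂ (s∈U i))) ≤-refl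
    ... | 1 | 0 | _ | _ = +-monoʳ-≤ 0# (·-monoʳ-≤ 1 (proj₁ (s∈U i)))
    ... | 1 | 1 | _ | _ = ≤-reflexive (+-comm _ _)
    ... | suc (suc _) | _ | s≤s () | _
    ... | 1 | suc (suc _) | _ | s≤s ()

  -- The adversary's cost compared with `price`.

  module _ {α : Carrier} where
    private
      -- Summands of the two sides of `adversary-bound`. The bits of `x′` and `y′` are arguments, so
      -- that matching on `Disjoint` evaluates them.
      left right : Fin n → ℕ → ℕ → Carrier
      left  i a b = (1 ∸ x i) · (α ⊓ (if 1 ≤ᵇ b then lower i else upper i)) + (a ℕ.+ b) · price α i
      right i a b = (1 ∸ x i) · (α ⊓ upper i) + (a · C i + b · (if 1 ≤ᵇ b then lower i else upper i))

      lower-exchange : ∀ i → (1 ∸ x i) · (α ⊓ lower i) + secondPrice α i ≈ (1 ∸ x i) · (α ⊓ upper i) + lower i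
      lower-exchange i with x i | x-binary i
      ... | 0 | _ = ≈-trans (+-congʳ (+-identityʳ _))
        (≈-trans (second-exchange α i) (+-congʳ (≈-sym (+-identityʳ _))))
      ... | 1 | _ = ≈-refl
      ... | suc (suc _) | s≤s ()

      left≤right : ∀ i {a b} → Disjoint a b → left i a b ≤ right i a b
      left≤right i neither = +-monoʳ-≤ _ (≤-reflexive (≈-sym (+-identityˡ 0#)))
      left≤right i first   = +-monoʳ-≤ _ (≤-trans (·-monoʳ-≤ 1 (price≤C α i)) (≤-reflexive (≈-sym (+-identityʳ _))))
      left≤right i second  = begin
        (1 ∸ x i) · (α ⊓ lower i) + 1 · price α i     ≤⟨ +-monoʳ-≤ _ (·-monoʳ-≤ 1 (price≤secondPrice α i)) ⟩
        (1 ∸ x i) · (α ⊓ lower i) + 1 · secondPrice α i ≈⟨ +-congˡ (+-identityʳ _) ⟩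
        (1 ∸ x i) · (α ⊓ lower i) + secondPrice α i   ≈⟨ lower-exchange i ⟩
        (1 ∸ x i) · (α ⊓ upper i) + lower i           ≈⟨ +-congˡ (≈-trans (+-identityˡ _) (+-identityʳ _)) ⟨
        (1 ∸ x i) · (α ⊓ upper i) + (0# + 1 · lower i) ∎

      right≤left : ∀ i {a b} → Disjoint a b → (a ≡ 1 → C i ≤ price α i) → (b ≡ 1 → secondPrice α i ≤ price α i) →
        right i a b ≤ left i a b
      right≤left i neither _ _ = +-monoʳ-≤ _ (≤-reflexive (+-identityˡ 0#))
      right≤left i first h _   = +-monoʳ-≤ _ (≤-trans (≤-reflexive (+-identityʳ _)) (·-monoʳ-≤ 1 (h refl)))
      right≤left i second _ h  = begin
        (1 ∸ x i) · (α ⊓ upper i) + (0# + 1 · lower i) ≈⟨ +-congˡ (≈-trans (+-identityˡ _) (+-identityʳ _)) ⟩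
        (1 ∸ x i) · (α ⊓ upper i) + lower i           ≈⟨ lower-exchange i ⟨
        (1 ∸ x i) · (α ⊓ lower i) + secondPrice α i   ≈⟨ +-congˡ (+-identityʳ _) ⟨
        (1 ∸ x i) · (α ⊓ lower i) + 1 · secondPrice α i ≤⟨ +-monoʳ-≤ _ (·-monoʳ-≤ 1 (h refl)) ⟩
        (1 ∸ x i) · (α ⊓ lower i) + 1 · price α i     ∎

      module _ (x′ y′ : Vector ℕ n) where
        left-sum : sum (λ i → left i (x′ i) (y′ i)) ≈ capped x (extreme y′) α + price α ᵀ (x′ +ᵛ y′)
        left-sum = ∑-distrib-+ (λ i → (1 ∸ x i) · (α ⊓ extreme y′ i)) _

        right-sum : sum (λ i → right i (x′ i) (y′ i)) ≈ capped x upper α + (C ᵀ x′ + extreme y′ ᵀ y′)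
        right-sum = ≈-trans (∑-distrib-+ (λ i → (1 ∸ x i) · (α ⊓ upper i)) _)
          (+-congˡ (∑-distrib-+ (λ i → x′ i · C i) _))

    -- A first-stage purchase pays `C i`. A second-stage one pays `lower i` plus the drop of its
    -- capped term, together `secondPrice α i`. Both are at least `price α i`, and an unbought
    -- element stays at its upper bound and contributes equally.
    adversary-bound : ∀ {x′ y′} → (x′ , y′) ∈ TwoStage p →
      capped x (extreme y′) α + price α ᵀ (x′ +ᵛ y′) ≤ capped x upper α + (C ᵀ x′ + extreme y′ ᵀ y′)
    adversary-bound {x′} {y′} (_ , _ , bin , _) = begin
      _ ≈⟨ left-sum x′ y′ ⟨
      _ ≤⟨ sum-mono-≤ (λ i → left≤right i (disjoint (x′ i) (y′ i) (bin i))) ⟩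
      _ ≈⟨ right-sum x′ y′ ⟩
      _ ∎

    -- The reverse of `adversary-bound`: every element of `z` is bought in the cheaper stage, which
    -- costs no more than `price` by `C⊓secondPrice≤price`.
    adversary-attains : ∀ {z} → z ∈ Recourse p 0ᵛ →
      let x′ = firstPart (secondPrice α) z
          y′ = secondPart (secondPrice α) z
      in capped x upper α + (C ᵀ x′ + extreme y′ ᵀ y′) ≤ capped x (extreme y′) α + price α ᵀ z
    adversary-attains {z} z∈R@(bin , _) = begin
      _ ≈⟨ right-sum x′ y′ ⟨
      _ ≤⟨ sum-mono-≤ (λ i → right≤left i (disjoint (x′ i) (y′ i) (bin′ i)) (first-case i) (second-case i)) ⟩
      _ ≈⟨ left-sum x′ y′ ⟩
      _ ≈⟨ +-congˡ (sum-cong-≋ (λ i → ≡⇒≈ (≡.cong (_· price α i) (parts-sum κ z i)))) ⟩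
      _ ∎
      where
      κ = secondPrice α
      x′ = firstPart κ z
      y′ = secondPart κ z
      bin′ : Binary (x′ +ᵛ y′)
      bin′ i = ℕ.≤-trans (ℕ.≤-reflexive (parts-sum κ z i)) (bin i)
      first-case : ∀ i → x′ i ≡ 1 → C i ≤ price α i
      first-case i with C i ≤? κ i
      ... | yes C≤κ = λ _ → ≤-trans (≤-reflexive (≈-sym (x≤y⇒x⊓y≈x C≤κ))) (C⊓secondPrice≤price α i)
      ... | no  _   = λ ()
      second-case : ∀ i → y′ i ≡ 1 → κ i ≤ price α i
      second-case i with C i ≤? κ i | total (C i) (κ i)
      ... | yes _   | _        = λ ()
      ... | no  C≰κ | inj₁ C≤κ = contradiction C≤κ C≰κ
      ... | no  _   | inj₂ κ≤C = λ _ → ≤-trans (≤-reflexive (≈-sym (x≥y⇒x⊓y≈y κ≤C))) (C⊓secondPrice≤price α i)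

  -- The function `regret` and its maximum.

  module _ {θl θu} {yl yu : Vector ℕ n}
           (yl∈R : yl ∈ Recourse p 0ᵛ) (thr-l : Threshold 0ᵛ yl l θl)
           (yu∈R : yu ∈ Recourse p 0ᵛ) (thr-u : Threshold 0ᵛ yu u θu) where

    regretTerms : Carrier → Vector Carrier n
    regretTerms α i = regretTerm (over i) (x i) (C i) (upper i) (l i) (u i) θl θu α

    regret : Carrier → Carrier
    regret α = sum (regretTerms α)

    -- The selection that witnesses `θ` may be traded for any `z` that is optimal by a threshold of
    -- its own, since optimal selections cost the same.
    capped-any : ∀ {y z : Vector ℕ n} {v θ θ′} → y ∈ Recourse p 0ᵛ → Threshold 0ᵛ y v θ →
      z ∈ Recourse p 0ᵛ → Threshold 0ᵛ z v θ′ → capped 0ᵛ v θ ≈ v ᵀ z + excess n p θ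
    capped-any {v = v} {θ} y∈R thr z∈R thr′ = antisym (capped≤ p≤n z∈R v θ)
      (≤-trans (+-mono-≤ (threshold-minimal p≤n z∈R thr′ y∈R) ≤-refl) (capped≥ p≤n y∈R v θ thr))

    module _ (α : Carrier) {z τ} (z∈R : z ∈ Recourse p 0ᵛ) (thr : Threshold 0ᵛ z (price α) τ) where
      private
        a = θl ⊔ α
        b = θu ⊓ α
        E = excess n p

        -- An order of the elements by price α also sorts l ⊔ α and u ⊓ α.
        capped-l : capped 0ᵛ (λ i → l i ⊔ α) a ≈ (λ i → l i ⊔ α) ᵀ z + E a
        capped-l = capped-any yl∈R (threshold-map (⊔-monoˡ-≤ α) thr-l) z∈R
          (threshold-resp (price-⊔ α) (threshold-map (⊔-monoˡ-≤ α) thr))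

        capped-u : capped 0ᵛ (λ i → u i ⊓ α) b ≈ (λ i → u i ⊓ α) ᵀ z + E b
        capped-u = capped-any yu∈R (threshold-map (⊓-monoˡ-≤ α) thr-u) z∈R
          (threshold-resp (price-⊓ α) (threshold-map (⊓-monoˡ-≤ α) thr))

        -- The summands are the minimum and the maximum of `price α i` and `α`, hence add up to
        -- `price α i` plus `α`.
        price-split : (λ i → u i ⊓ α) ᵀ z + (λ i → l i ⊔ α) ᵀ z ≈ price α ᵀ z + (λ _ → α) ᵀ z
        price-split = ≈-trans (≈-sym (∑-distrib-+ (λ i → z i · (u i ⊓ α)) _))
          (≈-trans (sum-cong-≋ pointwise) (∑-distrib-+ (λ i → z i · price α i) _))
          where
          pointwise : ∀ i → z i · (u i ⊓ α) + z i · (l i ⊔ α) ≈ z i · price α i + z i · α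
          pointwise i = ≈-trans (≈-sym (×-distrib-+ _ _ (z i))) (≈-trans
            (×-congʳ (z i) (≈-trans (≈-sym (+-cong (price-⊓ α i) (price-⊔ α i))) (⊓+⊔ (price α i) α)))
            (×-distrib-+ _ _ (z i)))

        all-α : sum {n} (λ _ → α) ≈ (λ _ → α) ᵀ z + E α
        all-α = ≈-trans (sum-cong-≋ pointwise)
          (≈-trans (∑-distrib-+ (λ i → z i · α) _) (+-congˡ (unselected-excess p≤n z∈R (price α) α)))
          where
          pointwise : ∀ i → α ≈ z i · α + (1 ∸ z i) · α
          pointwise i with z i | proj₁ z∈R i
          ... | 0 | _ = ≈-sym (≈-trans (+-identityˡ _) (+-identityʳ _))
          ... | 1 | _ = ≈-sym (≈-trans (+-identityʳ _) (+-identityʳ _))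
          ... | suc (suc _) | s≤s ()

        charge : Vector Carrier n
        charge i = if 1 ≤ᵇ x i then C i else α ⊓ upper i

        charge-sum : sum charge ≈ C ᵀ x + capped x upper α
        charge-sum = ≈-trans (sum-cong-≋ pointwise) (∑-distrib-+ (λ i → x i · C i) _)
          where
          pointwise : ∀ i → charge i ≈ x i · C i + (1 ∸ x i) · (α ⊓ upper i)
          pointwise i with x i | x-binary i
          ... | 0 | _ = ≈-sym (≈-trans (+-identityˡ _) (+-identityʳ _))
          ... | 1 | _ = ≈-sym (≈-trans (+-identityʳ _) (+-identityʳ _))
          ... | suc (suc _) | s≤s ()

        capped-terms : (v : Vector Carrier n) (θ : Carrier) → Vector Carrier n
        capped-terms v θ i = 1 · (θ ⊓ v i)

        ∑-distrib₄ : ∀ (f g h k : Vector Carrier n) →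
          sum (λ i → f i + g i + h i + k i) ≈ sum f + sum g + sum h + sum k
        ∑-distrib₄ f g h k = ≈-trans (∑-distrib-+ (λ i → f i + g i + h i) k)
          (+-congʳ (≈-trans (∑-distrib-+ (λ i → f i + g i) h) (+-congʳ (∑-distrib-+ f g))))

        slack-terms : Carrier → Vector Carrier n
        slack-terms θ i = slack p i · θ

        -- Adds back all that `regretTerm` subtracts, so that no negation remains when the summands
        -- are collected.
        balance : ∀ e γ q r → 
          ((if e then (γ + α) + a + b else γ + α) - (if e then (q + r) + α + α else q + r))
            + (1 · q + 1 · r + (if e then 1 else 0) · α + (if e then 1 else 0) · α)
          ≈ γ + α + (if e then 1 else 0) · a + (if e then 1 else 0) · b
        balance true  γ q r = ≈-trans (+-congˡ (over-neg q r α))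
          (≈-trans (-‿+-cancel _ _) (over-pos (γ + α) a b))
        balance false γ q r = ≈-trans (+-congˡ (under-neg q r))
          (≈-trans (-‿+-cancel _ _) (under-pos (γ + α)))

        terms : regret α + (capped 0ᵛ (λ i → l i ⊔ α) a + capped 0ᵛ (λ i → u i ⊓ α) b + E α + E α)
          ≈ sum charge + sum {n} (λ _ → α) + E a + E b
        terms = ≈-trans
          (+-congˡ (≈-sym (∑-distrib₄ (capped-terms (λ i → l i ⊔ α) a) (capped-terms (λ i → u i ⊓ α) b)
            (slack-terms α) (slack-terms α))))
          (≈-trans
            (sum-+ {f = regretTerms α} (λ i → balance (over i) (charge i) (a ⊓ (l i ⊔ α)) (b ⊓ (u i ⊓ α))))
            (∑-distrib₄ charge (λ _ → α) (slack-terms a) (slack-terms b)))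

      -- Identifies `regret α`: the first-stage cost, plus the dual recourse value at `α` with all
      -- costs at their upper bounds, minus the p cheapest elements at `price α`. The latter come
      -- from the dual totals for `l` and `u` through `price-split`; what remains is cancelled.
      regret-value : regret α + (price α ᵀ z + E α) ≈ C ᵀ x + capped x upper α
      regret-value = ≈-trans (∙-cancelʳ (const + E α + E a + E b) _ _ (begin-equality
        (regret α + (price α ᵀ z + E α)) + (const + E α + E a + E b)
          ≈⟨ value₁
               (regret α) (price α ᵀ z) const (E α) (E a) (E b) ⟩
        regret α + ((price α ᵀ z + const) + E a + E b + E α + E α)
          ≈⟨ +-congˡ (+-congʳ (+-congʳ (+-congʳ (+-congʳ price-split)))) ⟨
        regret α + (((λ i → u i ⊓ α) ᵀ z + (λ i → l i ⊔ α) ᵀ z) + E a + E b + E α + E α)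
          ≈⟨ +-congˡ (+-congʳ (+-congʳ (value₂ ((λ i → u i ⊓ α) ᵀ z) ((λ i → l i ⊔ α) ᵀ z) (E a) (E b)))) ⟩
        regret α + (((λ i → l i ⊔ α) ᵀ z + E a) + ((λ i → u i ⊓ α) ᵀ z + E b) + E α + E α)
          ≈⟨ +-congˡ (+-congʳ (+-congʳ (+-cong capped-l capped-u))) ⟨
        regret α + (capped 0ᵛ (λ i → l i ⊔ α) a + capped 0ᵛ (λ i → u i ⊓ α) b + E α + E α)
          ≈⟨ terms ⟩
        sum charge + sum {n} (λ _ → α) + E a + E b
          ≈⟨ +-congʳ (+-congʳ (+-congˡ all-α)) ⟩
        sum charge + (const + E α) + E a + E b
          ≈⟨ value₃
               (sum charge) const (E α) (E a) (E b) ⟩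
        sum charge + (const + E α + E a + E b) ∎)) charge-sum
        where
        const = (λ _ → α) ᵀ z

    Attained : Carrier → Set _
    Attained v = ∃[ s ] ∃[ inc ] ∃[ opt ] s ∈ Scenario I × IsInc I x s inc × IsOpt I s opt × v ≈ inc - opt

    -- For an optimal pair in `s`, passing to the scenario extreme for its second part does not
    -- lower the regret against that pair. Strong duality there yields an `α` whose `regret α`
    -- bounds this regret.
    regret-upper : ∀ {M} → regret 0# ≤ M → (∀ j → regret (lower j) ≤ M) → (∀ j → regret (upper j) ≤ M) →
      ∀ {v} → Attained v → v ≤ M
    regret-upper {M} at0 at-lower at-upper {v}
      (s , inc , opt , s∈U , (m , (_ , m-min) , inc≈) , ((x′ , y′ , xy∈Z , opt≈) , _) , v≈)
      with x-cheapest (extreme∈Scenario y′)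
    ... | y , y∈R , α , from , thr with p-cheapest (price α) (0≤price α)
    ...   | z , z∈R , τ , _ , thr-z = begin
      v                    ≈⟨ v≈ ⟩
      inc - opt            ≤⟨ +-cancelʳ-≤ opt (≤-respˡ-≈ (≈-sym (-‿+-cancel inc opt)) main) ⟩
      regret α             ≤⟨ candidate from ⟩
      M                    ∎
      where
      s′ = extreme y′
      E = excess n p
      K = capped x s′ α
      Q = capped x upper α
      W = price α ᵀ (x′ +ᵛ y′)
      -- The extreme scenario takes only interval bounds as values, which leaves `0#` and the bounds
      -- for `α`.
      candidate : FromValues s′ α → regret α ≤ M
      candidate (inj₁ refl) = at0
      candidate (inj₂ (j , eq)) with y′ j
      ... | 0     = ≡.subst (λ α → regret α ≤ M) (≡.sym eq) (at-upper j)
      ... | suc _ = ≡.subst (λ α → regret α ≤ M) (≡.sym eq) (at-lower j)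
      -- Five inequalities added: optimality of `m` in `s`, the change of scenario, tightness of
      -- duality at `α`, the adversary's bound, and minimality of `z`.
      steps : (m + (s ᵀ y + s′ ᵀ y′)) + ((s′ ᵀ y + E α) + ((K + W) + price α ᵀ z))
        ≤ (s ᵀ y + (s′ ᵀ y + s ᵀ y′)) + (K + ((Q + (C ᵀ x′ + s′ ᵀ y′)) + W))
      steps = +-mono-≤
        (+-mono-≤ (m-min (y , y∈R , ≈-refl)) (scenario-exchange s∈U (proj₁ (proj₂ xy∈Z)) (proj₁ y∈R)))
        (+-mono-≤ (capped≥ p≤n y∈R s′ α thr)
          (+-mono-≤ (adversary-bound xy∈Z) (threshold-minimal p≤n z∈R thr-z (total∈Recourse xy∈Z))))
      main : inc ≤ regret α + opt
      main = +-cancelʳ-≤ rest (begin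
        inc + rest
          ≈⟨ +-congʳ inc≈ ⟩
        (C ᵀ x + m) + rest
          ≈⟨ upper₁
               (C ᵀ x) m (s ᵀ y) (s′ ᵀ y′) (s′ ᵀ y) (E α) (K) (W) (price α ᵀ z) ⟩
        C ᵀ x + ((m + (s ᵀ y + s′ ᵀ y′)) + ((s′ ᵀ y + E α) + ((K + W) + price α ᵀ z)))
          ≤⟨ +-monoʳ-≤ (C ᵀ x) steps ⟩
        C ᵀ x + ((s ᵀ y + (s′ ᵀ y + s ᵀ y′)) + (K + ((Q + (C ᵀ x′ + s′ ᵀ y′)) + W)))
          ≈⟨ upper₂
               (C ᵀ x) (s ᵀ y) (s′ ᵀ y) (s ᵀ y′) (K) (Q) (C ᵀ x′) (s′ ᵀ y′) (W) ⟩
        (C ᵀ x + Q) + ((C ᵀ x′ + s ᵀ y′) + (s ᵀ y + s′ ᵀ y′ + s′ ᵀ y + K + W))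
          ≈⟨ +-cong (regret-value α z∈R thr-z) (+-congʳ opt≈) ⟨
        (regret α + (price α ᵀ z + E α)) + (opt + (s ᵀ y + s′ ᵀ y′ + s′ ᵀ y + K + W))
          ≈⟨ upper₃
               (regret α) (price α ᵀ z) (E α) opt (s ᵀ y) (s′ ᵀ y′) (s′ ᵀ y) (K) (W) ⟩
        (regret α + opt) + rest ∎)
        where
        rest = s ᵀ y + s′ ᵀ y′ + s′ ᵀ y + E α + K + W + price α ᵀ z

    -- Weak duality suffices, so any `α` will do. In the scenario extreme for the second part of
    -- `z`, the capped sum bounds the recourse from below, while the split of `z` bounds Opt from
    -- above.
    regret-attained : ∀ α → ∃[ v ] Attained v × regret α ≤ v
    regret-attained α with p-cheapest (price α) (0≤price α)
    ... | z , z∈R , τ , _ , thr-z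
      with extreme∈Scenario (secondPart (secondPrice α) z)
    ...   | s∈U with inc-exists s∈U | opt-exists s∈U
    ...     | inc , isInc@(m , ((y , y∈R , m≈) , _) , inc≈) | opt , isOpt@(_ , opt-min) =
      inc - opt , (s , inc , opt , s∈U , isInc , isOpt , ≈-refl)
        , +-cancelʳ-≤ opt (≤-respʳ-≈ (≈-sym (-‿+-cancel inc opt)) main)
      where
      x′ = firstPart (secondPrice α) z
      y′ = secondPart (secondPrice α) z
      s = extreme y′
      E = excess n p
      main : regret α + opt ≤ inc
      main = +-cancelʳ-≤ (price α ᵀ z + E α) (begin
        (regret α + opt) + (price α ᵀ z + E α)
          ≈⟨ attained₁ (regret α) opt (price α ᵀ z) (E α) ⟩
        (regret α + (price α ᵀ z + E α)) + opt
          ≈⟨ +-congʳ (regret-value α z∈R thr-z) ⟩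
        (C ᵀ x + capped x upper α) + opt
          ≤⟨ +-monoʳ-≤ _ (opt-min (x′ , y′ , parts∈TwoStage (secondPrice α) z∈R , ≈-refl)) ⟩
        (C ᵀ x + capped x upper α) + (C ᵀ x′ + s ᵀ y′)
          ≈⟨ +-assoc _ _ _ ⟩
        C ᵀ x + (capped x upper α + (C ᵀ x′ + s ᵀ y′))
          ≤⟨ +-monoʳ-≤ _ (adversary-attains z∈R) ⟩
        C ᵀ x + (capped x s α + price α ᵀ z)
          ≤⟨ +-monoʳ-≤ _ (+-mono-≤ (capped≤ p≤n y∈R s α) ≤-refl) ⟩
        C ᵀ x + ((s ᵀ y + E α) + price α ᵀ z)
          ≈⟨ attained₂ (C ᵀ x) (s ᵀ y) (E α) (price α ᵀ z) ⟩
        (C ᵀ x + s ᵀ y) + (price α ᵀ z + E α)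
          ≈⟨ +-congʳ (≈-trans inc≈ (+-congˡ m≈)) ⟨
        inc + (price α ᵀ z + E α) ∎)

    regret-max : ∀ α → regret 0# ≤ regret α → (∀ j → regret (lower j) ≤ regret α) →
      (∀ j → regret (upper j) ≤ regret α) → IsMaxRegret I x (regret α)
    regret-max α at0 at-lower at-upper = conclude (regret-attained α)
      where
      upper-bound : ∀ {v} → Attained v → v ≤ regret α
      upper-bound = regret-upper {regret α} at0 at-lower at-upper
      conclude : ∃[ v ] Attained v × regret α ≤ v → IsMaxRegret I x (regret α)
      conclude (v , att@(s , inc , opt , s∈U , isInc , isOpt , v≈) , ≤v) =
        -- The attained `v` is at least `regret α`, and at most that by the upper bound, so
        -- `regret α` is itself attained.
        (s , inc , opt , s∈U , isInc , isOpt , ≈-trans (antisym ≤v (upper-bound att)) v≈) , upper-bound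

-- Boolean comparison, memory writes and growth rates.

≤⇒≤ᵇ-true : ∀ {m n} → m ℕ.≤ n → (m ≤ᵇ n) ≡ true
≤⇒≤ᵇ-true = Equivalence.to T-≡ ∘ ℕ.≤⇒≤ᵇ

<⇒≤ᵇ-false : ∀ {m n} → n ℕ.< m → (m ≤ᵇ n) ≡ false
<⇒≤ᵇ-false {m} {n} n<m with m ≤ᵇ n in eq
... | true  = contradiction (ℕ.≤ᵇ⇒≤ m n (Equivalence.from T-≡ eq)) (ℕ.<⇒≱ n<m)
... | false = refl

write-below : ∀ {a} {A : Set a} {x b} → b ℕ.< x → ∀ i v (m : Memory A) j → write x i v m b j ≡ m b j
write-below {x = x} {b} b<x i v m j with x ≡ᵇ b in eq
... | true  = contradiction (ℕ.≡ᵇ⇒≡ x b (Equivalence.from T-≡ eq)) (ℕ.>⇒≢ b<x)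
... | false = refl

O-const : ∀ c k → (λ _ → c) ∈ O (_^ k)
-- The bound starts at 1 because `0 ^ k` vanishes for positive `k`.
O-const c k = c , 1 , λ n 1≤n → ℕ.≤-trans (ℕ.≤-reflexive (≡.sym (ℕ.*-identityʳ c)))
  (ℕ.*-monoʳ-≤ c (≡.subst (ℕ._≤ n ^ k) (ℕ.^-zeroˡ k) (ℕ.^-monoˡ-≤ k 1≤n)))

O-+ : ∀ k {S T} → S ∈ O (_^ k) → T ∈ O (_^ k) → (λ n → S n ℕ.+ T n) ∈ O (_^ k)
O-+ k (K , M , S≤) (L , N , T≤) = K ℕ.+ L , M ℕ.⊔ N , λ n h →
  ℕ.≤-trans (ℕ.+-mono-≤ (S≤ n (ℕ.≤-trans (ℕ.m≤m⊔n M N) h)) (T≤ n (ℕ.≤-trans (ℕ.m≤n⊔m M N) h)))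
    (ℕ.≤-reflexive (≡.sym (ℕ.*-distribʳ-+ (n ^ k) K L)))

O-*ˡ : ∀ k {T} → T ∈ O (_^ k) → (λ n → n ℕ.* T n) ∈ O (_^ suc k)
O-*ˡ k (K , N , T≤) = K , N , λ n h → ℕ.≤-trans (ℕ.*-monoʳ-≤ n (T≤ n h))
  (ℕ.≤-reflexive (≡.trans (≡.sym (ℕ.*-assoc n K (n ^ k)))
    (≡.trans (≡.cong (ℕ._* n ^ k) (ℕ.*-comm n K)) (ℕ.*-assoc K n (n ^ k)))))

O-twice-*ˡ : ∀ k {T} → T ∈ O (_^ k) → (λ n → (n ℕ.+ n) ℕ.* T n) ∈ O (_^ suc k)
O-twice-*ˡ k {T} T∈ with O-+ (suc k) (O-*ˡ k {T} T∈) (O-*ˡ k {T} T∈)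
... | K , N , h = K , N , λ n N≤n → ℕ.≤-trans (ℕ.≤-reflexive (ℕ.*-distribʳ-+ (T n) n n)) (h n N≤n)

-- Register conventions.  Numbers: 0–2 input, 3 output, 4 and 5 the
-- thresholds of the lower and upper prices, 6 argument and 7 value of the best
-- candidate so far, 8 candidate, 9 accumulator, from 10 on temporaries.
-- Naturals: 0 and 1 input, 2 outer and 3 inner loop counter.

cell : ℕ → NExp
cell a = num a [ lit 0 ]

temp : ℕ → NExp
temp r = cell (10 ℕ.+ r)

counter : ℕ → IExp
counter c = int c [ lit 0 ]

-- Straight-line blocks and the two loops built on them.

record Assignment : Set where
  constructor assign
  field
    register : ℕ
    test     : Test
    then-exp : NExp
    else-exp : NExp

Block : Set
Block = List Assignment

set : ℕ → NExp → Assignment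
set r e = assign r (lit 0 ≤ᴵ lit 0) e e

minimum maximum : ℕ → NExp → NExp → Assignment
minimum r e f = assign r (e ≤ᴺ f) e f
maximum r e f = assign r (e ≤ᴺ f) f e

choose : ℕ → Test → NExp → NExp → Program
choose a b e f = ifᴾ b then (num a [ lit 0 ]≔ e) else (num a [ lit 0 ]≔ f)

-- Both branches are charged, which bounds the time whichever is taken.
chooseCost : Test → NExp → NExp → ℕ
chooseCost b e f = 1 ℕ.+ costᵀ b ℕ.+ ((2 ℕ.+ costᴺ e) ℕ.+ (2 ℕ.+ costᴺ f))

compile : Block → Program
compile []                     = skip
compile (assign r b e f ∷ blk) = choose (10 ℕ.+ r) b e f ⨾ compile blk

blockCost : Block → ℕ
blockCost []                     = 1
blockCost (assign r b e f ∷ blk) = chooseCost b e f ℕ.+ blockCost blk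

increment : ℕ → Program
increment c = int c [ lit 0 ]≔ counter c ⊕ lit 1

below : ℕ → IExp → Test
below c bound = counter c ⊕ lit 1 ≤ᴵ bound

-- The argument of the sum is in register 8. In each round `term` leaves a minuend and a subtrahend
-- in the first two temporaries.
evaluate : Block → Program
evaluate term =
  num 9 [ lit 0 ]≔ 0ᴺ ⨾
  int 3 [ lit 0 ]≔ lit 0 ⨾
  while below 3 (int 0 [ lit 0 ]) loop
    (compile term ⨾
     num 9 [ lit 0 ]≔ cell 9 +ᴺ (temp 0 -ᴺ temp 1) ⨾
     increment 3)

-- The argument `0#` is tried first, then 2n candidates. That is the number of interval bounds; a
-- search over n prices merely tries some padding as well.
maximise : Block → Block → Program
maximise candidate term =
  num 8 [ lit 0 ]≔ 0ᴺ ⨾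
  evaluate term ⨾
  num 7 [ lit 0 ]≔ cell 9 ⨾
  num 6 [ lit 0 ]≔ cell 8 ⨾
  int 2 [ lit 0 ]≔ lit 0 ⨾
  while below 2 (int 0 [ lit 0 ] ⊕ int 0 [ lit 0 ]) loop
    (compile candidate ⨾
     num 8 [ lit 0 ]≔ temp 0 ⨾
     evaluate term ⨾
     -- Register 6 is updated before register 7, so that both updates see the same outcome of the
     -- test.
     choose 6 (cell 7 ≤ᴺ cell 9) (cell 8) (cell 6) ⨾
     choose 7 (cell 7 ≤ᴺ cell 9) (cell 9) (cell 7) ⨾
     increment 2)

-- The literals are the costs of the individual commands, in program order.
evaluateCost : Block → ℕ → ℕ
evaluateCost term n = 3 ℕ.+ (3 ℕ.+ (n ℕ.* (8 ℕ.+ (blockCost term ℕ.+ (10 ℕ.+ 6))) ℕ.+ 8))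

maximiseCost : Block → Block → ℕ → ℕ
maximiseCost candidate term n =
  3 ℕ.+ (evaluateCost term n ℕ.+ (4 ℕ.+ (4 ℕ.+ (3 ℕ.+ ((n ℕ.+ n) ℕ.*
    (11 ℕ.+ (blockCost candidate ℕ.+ (4 ℕ.+ (evaluateCost term n ℕ.+ (14 ℕ.+ (14 ℕ.+ 6)))))) ℕ.+ 11)))))

maximiseCost∈O : ∀ candidate term → maximiseCost candidate term ∈ O (_^ 2)
maximiseCost∈O candidate term =
  O-+ 2 (O-const 3 2) (O-+ 2 (evaluate∈O 1) (O-+ 2 (O-const 4 2) (O-+ 2 (O-const 4 2) (O-+ 2 (O-const 3 2)
    (O-+ 2 (O-twice-*ˡ 1 (O-+ 1 (O-const 11 1) (O-+ 1 (O-const (blockCost candidate) 1)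
      (O-+ 1 (O-const 4 1) (O-+ 1 (evaluate∈O 0) (O-const _ 1)))))) (O-const 11 2))))))
  where
  evaluate∈O : ∀ k → evaluateCost term ∈ O (_^ suc k)
  evaluate∈O k = O-+ (suc k) (O-const 3 (suc k)) (O-+ (suc k) (O-const 3 (suc k))
    (O-+ (suc k) (O-*ˡ k (O-const _ k)) (O-const 8 (suc k))))

-- Rules for total correctness with time bounds.

module Execution {c ℓ₁ ℓ₂} (F : OrderedField c ℓ₁ ℓ₂) where
  open OrderedField F
  open OrderedFieldProperties F using (≤-refl; ≤-trans; total)
  open Machine F

  Runs : ∀ {ℓ} → Program → State → ℕ → Pred State ℓ → Set _
  Runs P σ t Ψ = ∃[ σ′ ] ∃[ u ] ⟨ P , σ ⟩⇓ σ′ in-time u × u ℕ.≤ t × Ψ σ′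

  runs-seq : ∀ {ℓ ℓ′} {Φ : Pred State ℓ} {Ψ : Pred State ℓ′} {P Q σ t u} → Runs P σ t Φ →
    (∀ {σ′} → Φ σ′ → Runs Q σ′ u Ψ) → Runs (P ⨾ Q) σ (t ℕ.+ u) Ψ
  runs-seq (_ , _ , P⇓ , t≤ , φ) k with k φ
  ... | _ , _ , Q⇓ , u≤ , ψ = _ , _ , seq⇓ P⇓ Q⇓ , ℕ.+-mono-≤ t≤ u≤ , ψ

  runs-num : ∀ {ℓ} {Ψ : Pred State ℓ} {σ a e} →
    Ψ ⟪ ints σ , write a 0 (⟦ e ⟧ᴺ σ) (nums σ) ⟫ → Runs (num a [ lit 0 ]≔ e) σ (2 ℕ.+ costᴺ e) Ψ
  runs-num ψ = _ , _ , num⇓ , ℕ.≤-refl , ψ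

  runs-int : ∀ {ℓ} {Ψ : Pred State ℓ} {σ a e} →
    Ψ ⟪ write a 0 (⟦ e ⟧ᴵ σ) (ints σ) , nums σ ⟫ → Runs (int a [ lit 0 ]≔ e) σ (2 ℕ.+ costᴵ e) Ψ
  runs-int ψ = _ , _ , int⇓ , ℕ.≤-refl , ψ

  chosen : ℕ → Test → NExp → NExp → State → State
  chosen a b e f σ = ⟪ ints σ , write a 0 (if ⟦ b ⟧ᵀ σ then ⟦ e ⟧ᴺ σ else ⟦ f ⟧ᴺ σ) (nums σ) ⟫

  runs-choose : ∀ {ℓ} {Ψ : Pred State ℓ} {σ a b e f} →
    Ψ (chosen a b e f σ) → Runs (choose a b e f) σ (chooseCost b e f) Ψ
  runs-choose {Ψ = Ψ} {σ} {a} {b} {e} {f} ψ with ⟦ b ⟧ᵀ σ in eq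
  ... | true  = _ , _ , then⇓ eq num⇓ , ℕ.+-monoʳ-≤ (1 ℕ.+ costᵀ b) (ℕ.m≤m+n _ _) , ψ
  ... | false = _ , _ , else⇓ eq num⇓ , ℕ.+-monoʳ-≤ (1 ℕ.+ costᵀ b) (ℕ.m≤n+m _ (2 ℕ.+ costᴺ e)) , ψ

  run : Block → State → State
  run []                     σ = σ
  run (assign r b e f ∷ blk) σ = run blk (chosen (10 ℕ.+ r) b e f σ)

  runs-block : ∀ {ℓ} {Ψ : Pred State ℓ} blk {σ} → Ψ (run blk σ) → Runs (compile blk) σ (blockCost blk) Ψ
  runs-block []                     ψ = _ , _ , skip⇓ , ℕ.≤-refl , ψ
  runs-block (assign r b e f ∷ blk) {σ} ψ =
    runs-seq {Φ = _≡ chosen (10 ℕ.+ r) b e f σ} (runs-choose refl) λ { refl → runs-block blk ψ }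

  -- The invariant carries the iteration count, which alone decides the test. Induction on the
  -- number of remaining rounds then gives both termination and the time bound.
  runs-while : ∀ {ℓ b P t N} (Inv : ℕ → Pred State ℓ) →
    (∀ {k σ} → Inv k σ → ⟦ b ⟧ᵀ σ ≡ (k ℕ.+ 1 ≤ᵇ N)) →
    (∀ {k σ} → k ℕ.< N → Inv k σ → Runs P σ t (Inv (suc k))) →
    ∀ {k σ} → k ℕ.≤ N → Inv k σ →
    Runs (while b loop P) σ ((N ∸ k) ℕ.* (1 ℕ.+ costᵀ b ℕ.+ t) ℕ.+ (1 ℕ.+ costᵀ b)) (Inv N)
  runs-while {b = b} {P} {t} {N} Inv test step {k} k≤N inv =
    go (N ∸ k) (≡.trans (ℕ.+-comm k (N ∸ k)) (ℕ.m∸n+n≡m k≤N)) inv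
    where
    go : ∀ m {k σ} → k ℕ.+ m ≡ N → Inv k σ →
      Runs (while b loop P) σ (m ℕ.* (1 ℕ.+ costᵀ b ℕ.+ t) ℕ.+ (1 ℕ.+ costᵀ b)) (Inv N)
    go zero {k} {σ} eq inv = _ , _ , stop⇓ (≡.trans (test inv)
        (<⇒≤ᵇ-false (≡.subst (ℕ._< k ℕ.+ 1) k≡N (ℕ.m<m+n k (s≤s z≤n)))))
      , ℕ.≤-refl , ≡.subst (λ k → Inv k σ) k≡N inv
      where
      k≡N = ≡.trans (≡.sym (ℕ.+-identityʳ k)) eq
    go (suc m) {k} {σ} eq inv with step (≡.subst (k ℕ.<_) eq (ℕ.m<m+n k (s≤s z≤n))) inv
    ... | _ , _ , P⇓ , u≤t , inv′ with go m (≡.trans (≡.sym (ℕ.+-suc k m)) eq) inv′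
    ...   | _ , _ , rest⇓ , v≤ , ψ = _ , _
      , loop⇓ (≡.trans (test inv) (≤⇒≤ᵇ-true
          (≡.subst (k ℕ.+ 1 ℕ.≤_) eq (ℕ.+-monoʳ-≤ k (s≤s z≤n))))) P⇓ rest⇓
      , ℕ.≤-trans (ℕ.+-mono-≤ (ℕ.+-monoʳ-≤ (1 ℕ.+ costᵀ b) u≤t) v≤)
          (ℕ.≤-reflexive (≡.sym (ℕ.+-assoc (1 ℕ.+ costᵀ b ℕ.+ t) _ _)))
      , ψ

  -- The frame condition. Registers are allotted so that what a phase preserves is always an initial
  -- segment: `evaluate` keeps numbers below 9 and naturals below 3, `maximise` those below 6 and 2.
  record Agree (k m : ℕ) (σ σ′ : State) : Set c where
    constructor agree
    field
      nums-agree : ∀ {a} → a ℕ.< k → ∀ i → nums σ′ a i ≡ nums σ a i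
      ints-agree : ∀ {a} → a ℕ.< m → ∀ i → ints σ′ a i ≡ ints σ a i
  open Agree public

  agree-trans : ∀ {k m σ σ′ σ″} → Agree k m σ σ′ → Agree k m σ′ σ″ → Agree k m σ σ″
  agree-trans (agree nums₁ ints₁) (agree nums₂ ints₂) =
    agree (λ a<k i → ≡.trans (nums₂ a<k i) (nums₁ a<k i)) (λ a<m i → ≡.trans (ints₂ a<m i) (ints₁ a<m i))

  agree-weaken : ∀ {k k′ m m′ σ σ′} → k′ ℕ.≤ k → m′ ℕ.≤ m → Agree k m σ σ′ → Agree k′ m′ σ σ′
  agree-weaken k′≤k m′≤m (agree n i) = agree (λ a< → n (ℕ.≤-trans a< k′≤k)) (λ a< → i (ℕ.≤-trans a< m′≤m))

  agree-num : ∀ {k m σ σ′} a {v} → k ℕ.≤ a → Agree k m σ σ′ →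
    Agree k m σ ⟪ ints σ′ , write a 0 v (nums σ′) ⟫
  agree-num {σ′ = σ′} a {v} k≤a (agree n i) =
    agree (λ a<k j → ≡.trans (write-below (ℕ.≤-trans a<k k≤a) 0 v (nums σ′) j) (n a<k j)) i

  agree-int : ∀ {k m σ σ′} a {v} → m ℕ.≤ a → Agree k m σ σ′ →
    Agree k m σ ⟪ write a 0 v (ints σ′) , nums σ′ ⟫
  agree-int {σ′ = σ′} a {v} m≤a (agree n i) =
    agree n (λ a<m j → ≡.trans (write-below (ℕ.≤-trans a<m m≤a) 0 v (ints σ′) j) (i a<m j))

  agree-refl : ∀ {k m σ} → Agree k m σ σ
  agree-refl = agree (λ _ _ → refl) (λ _ _ → refl)

  run-ints : ∀ blk σ → ints (run blk σ) ≡ ints σ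
  run-ints []                     σ = refl
  run-ints (assign r b e f ∷ blk) σ = run-ints blk _

  agree-run : ∀ {k m σ σ′} → k ℕ.≤ 10 → ∀ blk → Agree k m σ σ′ → Agree k m σ (run blk σ′)
  agree-run k≤10 []                     ag = ag
  agree-run k≤10 (assign r b e f ∷ blk) ag =
    agree-run k≤10 blk (agree-num (10 ℕ.+ r) (ℕ.≤-trans k≤10 (ℕ.m≤m+n 10 r)) ag)

  -- Associated to the left, in the order of the machine's additions, so that the accumulator agrees
  -- with it up to `_≡_`.
  partialSum : (ℕ → Carrier) → ℕ → Carrier
  partialSum f zero    = 0#
  partialSum f (suc k) = partialSum f k + f k

  difference : State → Carrier
  difference σ = nums σ 10 0 - nums σ 11 0

  runs-evaluate : ∀ {σ₀ N} term f → ints σ₀ 0 0 ≡ N →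
    (∀ {σ} → Agree 9 3 σ₀ σ → difference (run term σ) ≡ f (ints σ 3 0)) →
    Runs (evaluate term) σ₀ (evaluateCost term N) (λ σ → Agree 9 3 σ₀ σ × nums σ 9 0 ≡ partialSum f N)
  runs-evaluate {σ₀} {N} term f size spec =
    runs-seq {Φ = λ σ → Agree 9 3 σ₀ σ × nums σ 9 0 ≡ 0#}
      (runs-num (agree-num 9 ℕ.≤-refl agree-refl , refl)) λ (ag , acc) →
    runs-seq {Φ = Inv 0} (runs-int (agree-int 3 ℕ.≤-refl ag , refl , acc)) λ inv →
    map₂ (map₂ (map₂ (map₂ λ (ag , _ , acc) → ag , acc)))
      (runs-while Inv test step z≤n inv)
    where
    Inv : ℕ → Pred State c
    Inv k σ = Agree 9 3 σ₀ σ × ints σ 3 0 ≡ k × nums σ 9 0 ≡ partialSum f k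
    test : ∀ {k σ} → Inv k σ → (ints σ 3 0 ℕ.+ 1 ≤ᵇ ints σ 0 0) ≡ (k ℕ.+ 1 ≤ᵇ N)
    test (ag , count , _) = ≡.cong₂ _≤ᵇ_ (≡.cong (ℕ._+ 1) count) (≡.trans (ints-agree ag (s≤s z≤n) 0) size)
    step : ∀ {k σ} → k ℕ.< N → Inv k σ → Runs _ σ _ (Inv (suc k))
    step {k} {σ} _ (ag , count , acc) =
      runs-seq {Φ = _≡ run term σ} (runs-block term refl) λ { refl →
      runs-seq {Φ = λ σ′ → Agree 9 3 σ₀ σ′ × ints σ′ 3 0 ≡ k × nums σ′ 9 0 ≡ partialSum f (suc k)}
        (runs-num (agree-num 9 ℕ.≤-refl (agree-run (ℕ.m≤m+n 9 1) term ag)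
          , ≡.trans (≡.cong (λ m → m 3 0) (run-ints term σ)) count
          , ≡.cong₂ _+_ (≡.trans (nums-agree (agree-run {10} {0} ℕ.≤-refl term agree-refl) (ℕ.n<1+n 9) 0) acc)
              (≡.trans (spec ag) (≡.cong f count)))) λ (ag′ , count′ , acc′) →
      runs-int (agree-int 3 ℕ.≤-refl ag′ , ≡.trans (ℕ.+-comm _ 1) (≡.cong suc count′) , acc′) }

  IsBest : (ℕ → Carrier) → (Carrier → Carrier) → ℕ → State → Set _
  IsBest candidates value k σ =
    nums σ 7 0 ≡ value (nums σ 6 0) × value 0# ≤ nums σ 7 0 × (∀ {j} → j ℕ.< k → value (candidates j) ≤ nums σ 7 0)

  runs-maximise : ∀ {σ₀ N} candidate term candidates (f : Carrier → ℕ → Carrier) → ints σ₀ 0 0 ≡ N →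
    (∀ {σ} → Agree 6 2 σ₀ σ → nums (run candidate σ) 10 0 ≡ candidates (ints σ 2 0)) →
    (∀ {σ} → Agree 6 2 σ₀ σ → difference (run term σ) ≡ f (nums σ 8 0) (ints σ 3 0)) →
    Runs (maximise candidate term) σ₀ (maximiseCost candidate term N)
      (λ σ → Agree 6 2 σ₀ σ × IsBest candidates (λ α → partialSum (f α) N) (N ℕ.+ N) σ)
  runs-maximise {σ₀} {N} candidate term candidates f size cand-spec term-spec =
    runs-seq {Φ = λ σ → Agree 6 2 σ₀ σ × nums σ 8 0 ≡ 0#}
      (runs-num (agree-num 8 (ℕ.m≤m+n 6 2) agree-refl , refl)) λ (ag , cand) →
    runs-seq (eval ag) λ (ag′ , cand′ , acc) →
    runs-seq {Φ = λ σ → Agree 6 2 σ₀ σ × nums σ 8 0 ≡ 0# × nums σ 7 0 ≡ value 0#}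
      (runs-num (agree-num 7 (ℕ.m≤m+n 6 1) ag′ , ≡.trans cand′ cand 
          , ≡.trans acc (≡.cong value cand))) λ (ag , cand , best) →
    runs-seq {Φ = λ σ → Agree 6 2 σ₀ σ × nums σ 6 0 ≡ 0# × nums σ 7 0 ≡ value 0#}
      (runs-num (agree-num 6 ℕ.≤-refl ag , cand , best)) λ (ag , arg , best) →
    runs-seq {Φ = Inv 0} (runs-int (agree-int 2 ℕ.≤-refl ag , refl
      , ≡.trans best (≡.cong value (≡.sym arg)) , ≡.subst (value 0# ≤_) (≡.sym best) ≤-refl , λ ())) λ inv →
    map₂ (map₂ (map₂ (map₂ λ (ag , _ , best) → ag , best)))
      (runs-while Inv test step z≤n inv)
    where
    value : Carrier → Carrier
    value α = partialSum (f α) N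
    Inv : ℕ → Pred State _
    Inv k σ = Agree 6 2 σ₀ σ × ints σ 2 0 ≡ k × IsBest candidates value k σ
    test : ∀ {k σ} → Inv k σ → (ints σ 2 0 ℕ.+ 1 ≤ᵇ ints σ 0 0 ℕ.+ ints σ 0 0) ≡ (k ℕ.+ 1 ≤ᵇ N ℕ.+ N)
    test (ag , count , _) = ≡.cong₂ _≤ᵇ_ (≡.cong (ℕ._+ 1) count) (≡.cong₂ ℕ._+_ n≡N n≡N)
      where
      n≡N = ≡.trans (ints-agree ag (s≤s z≤n) 0) size
    Evaluated : State → Pred State c
    Evaluated σ σ′ = Agree 6 2 σ₀ σ′ × nums σ′ 8 0 ≡ nums σ 8 0 × nums σ′ 9 0 ≡ value (nums σ 8 0)
    eval₀ : ∀ {σ} → Agree 6 2 σ₀ σ → Runs (evaluate term) σ (evaluateCost term N)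
      (λ σ′ → Agree 9 3 σ σ′ × nums σ′ 9 0 ≡ value (nums σ 8 0))
    eval₀ {σ} ag = runs-evaluate term (f (nums σ 8 0)) (≡.trans (ints-agree ag (s≤s z≤n) 0) size)
      λ {σ′} ag′ → ≡.trans (term-spec (agree-trans ag (agree-weaken (ℕ.m≤m+n 6 3) (ℕ.m≤m+n 2 1) ag′)))
        (≡.cong (λ α → f α (ints σ′ 3 0)) (nums-agree ag′ (ℕ.n<1+n 8) 0))
    eval : ∀ {σ} → Agree 6 2 σ₀ σ → Runs (evaluate term) σ (evaluateCost term N) (Evaluated σ)
    eval {σ} ag with eval₀ ag
    ... | σ′ , u , ⇓ , u≤ , ag′ , acc = σ′ , u , ⇓ , u≤
      , agree-trans ag (agree-weaken (ℕ.m≤m+n 6 3) (ℕ.m≤m+n 2 1) ag′) , nums-agree ag′ (ℕ.n<1+n 8) 0 , acc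
    Tested : ℕ → Pred State _
    Tested k σ = Agree 6 2 σ₀ σ × ints σ 2 0 ≡ k × IsBest candidates value k σ ×
      nums σ 8 0 ≡ candidates k × nums σ 9 0 ≡ value (nums σ 8 0)
    update : State → State
    update = chosen 7 (cell 7 ≤ᴺ cell 9) (cell 9) (cell 7) ∘ chosen 6 (cell 7 ≤ᴺ cell 9) (cell 8) (cell 6)
    update-best : ∀ {k σ} → Tested k σ → IsBest candidates value (suc k) (update σ)
    update-best {k} {σ} (_ , _ , (arg , at0 , at-candidates) , cand , acc)
      with nums σ 7 0 ≤? nums σ 9 0
    ... | yes improves = acc , ≤-trans at0 improves , λ j≤k → at (ℕ.m≤n⇒m<n∨m≡n (ℕ.≤-pred j≤k))
      where
      at : ∀ {j} → j ℕ.< k ⊎ j ≡ k → value (candidates j) ≤ nums σ 9 0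
      at (inj₁ j<k)  = ≤-trans (at-candidates j<k) improves
      at (inj₂ refl) = ≡.subst (_≤ nums σ 9 0) (≡.trans acc (≡.cong value cand)) ≤-refl
    ... | no not-improves = arg , at0 , λ j≤k → at (ℕ.m≤n⇒m<n∨m≡n (ℕ.≤-pred j≤k)) (total (nums σ 7 0) (nums σ 9 0))
      where
      at : ∀ {j} → j ℕ.< k ⊎ j ≡ k → nums σ 7 0 ≤ nums σ 9 0 ⊎ nums σ 9 0 ≤ nums σ 7 0 →
        value (candidates j) ≤ nums σ 7 0
      at (inj₁ j<k)  _           = at-candidates j<k
      at (inj₂ refl) (inj₁ h)    = contradiction h not-improves
      at (inj₂ refl) (inj₂ h)    = ≡.subst (_≤ nums σ 7 0) (≡.trans acc (≡.cong value cand)) h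
    step : ∀ {k σ} → k ℕ.< N ℕ.+ N → Inv k σ → Runs _ σ _ (Inv (suc k))
    step {k} {σ} _ (ag , count , best) =
      runs-seq {Φ = λ σ′ → Agree 10 3 σ σ′ × nums σ′ 10 0 ≡ candidates k}
        (runs-block candidate (agree-run ℕ.≤-refl candidate agree-refl 
          , ≡.trans (cand-spec ag) (≡.cong candidates count))) λ (ag₁ , cand₁) →
      runs-seq {Φ = λ σ′ → Agree 8 3 σ σ′ × nums σ′ 8 0 ≡ candidates k}
        (runs-num (agree-num 8 ℕ.≤-refl (agree-weaken (ℕ.m≤m+n 8 2) ℕ.≤-refl ag₁) , cand₁)) λ (ag₂ , cand₂) →
      runs-seq {Φ = Tested k} (evaluated ag₂ cand₂) λ {σ₃} tested@(ag₃ , count₃ , _) →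
      runs-seq {Φ = _≡ chosen 6 (cell 7 ≤ᴺ cell 9) (cell 8) (cell 6) σ₃} (runs-choose refl) λ { refl →
      runs-seq {Φ = λ σ′ → Agree 6 2 σ₀ σ′ × ints σ′ 2 0 ≡ k × IsBest candidates value (suc k) σ′}
        (runs-choose (agree-num 7 (ℕ.m≤m+n 6 1) (agree-num 6 ℕ.≤-refl ag₃) , count₃ 
          , update-best tested)) λ (ag₄ , count₄ , best₄) →
      runs-int (agree-int 2 ℕ.≤-refl ag₄ , ≡.trans (ℕ.+-comm _ 1) (≡.cong suc count₄) , best₄) }
      where
      evaluated : ∀ {σ₂} → Agree 8 3 σ σ₂ → nums σ₂ 8 0 ≡ candidates k →
        Runs (evaluate term) σ₂ (evaluateCost term N) (Tested k)
      evaluated {σ₂} ag₂ cand₂ with eval₀ (agree-trans ag (agree-weaken (ℕ.m≤m+n 6 2) (ℕ.m≤m+n 2 1) ag₂))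
      ... | σ₃ , u , ⇓ , u≤ , ag₃ , acc = σ₃ , u , ⇓ , u≤
        , agree-trans ag (agree-weaken (ℕ.m≤m+n 6 2) (ℕ.m≤m+n 2 1) ag₂₃)
        , ≡.trans (ints-agree ag₂₃ (ℕ.n<1+n 2) 0) count
        , best-resp (nums-agree ag₂₃ (ℕ.m≤m+n 7 1) 0) (nums-agree ag₂₃ (ℕ.n<1+n 7) 0) best
        , ≡.trans (nums-agree ag₃ (ℕ.n<1+n 8) 0) cand₂
        , ≡.trans acc (≡.cong value (≡.sym (nums-agree ag₃ (ℕ.n<1+n 8) 0)))
        where
        ag₂₃ : Agree 8 3 σ σ₃
        ag₂₃ = agree-trans ag₂ (agree-weaken (ℕ.m≤m+n 8 1) ℕ.≤-refl ag₃)
        best-resp : nums σ₃ 6 0 ≡ nums σ 6 0 → nums σ₃ 7 0 ≡ nums σ 7 0 →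
          IsBest candidates value k σ → IsBest candidates value k σ₃
        best-resp eq₆ eq₇ (arg , at0 , at) rewrite eq₆ | eq₇ = arg , at0 , at

-- The program and its running time.

load-toℕ : ∀ {a} {A : Set a} {n} (d : A) (v : Vector A n) i → load d v (toℕ i) ≡ v i
load-toℕ d v zero    = refl
load-toℕ d v (suc i) = load-toℕ d (tail v) i

inner outer size selected : IExp
inner = counter 3
outer = counter 2
size = int 0 [ lit 0 ]
selected = int 0 [ lit 1 ]

lowerPriceᴮ upperPriceᴮ : IExp → Block
lowerPriceᴮ k = minimum 0 (num 0 [ k ]) (num 1 [ k ]) ∷ []
upperPriceᴮ k =
  minimum 0 (num 0 [ k ]) (num 1 [ k ]) ∷
  minimum 1 (num 0 [ k ]) (num 2 [ k ]) ∷
  assign 0 (lit 1 ≤ᴵ int 1 [ k ]) (temp 0) (temp 1) ∷ []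

dualᴮ : Block
dualᴮ = minimum 0 (cell 8) (temp 0) ∷ assign 1 (selected ≤ᴵ inner) (cell 8) 0ᴺ ∷ []

opaque
  -- Temporaries 4 and 5 hold the `a` and `b` of `regretTerm`, 0 and 1 its two sides. Temporaries 2
  -- and 3 start as the two prices and become the summands of `q`. The block is opaque so that its
  -- run is unfolded only in `regret-run`.
  regretᴮ : Block
  regretᴮ =
    minimum 2 (num 0 [ inner ]) (num 1 [ inner ]) ∷
    minimum 3 (num 0 [ inner ]) (num 2 [ inner ]) ∷
    assign 3 (lit 1 ≤ᴵ int 1 [ inner ]) (temp 2) (temp 3) ∷
    maximum 4 (cell 4) (cell 8) ∷
    minimum 5 (cell 5) (cell 8) ∷
    maximum 2 (temp 2) (cell 8) ∷
    minimum 2 (temp 4) (temp 2) ∷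
    minimum 3 (temp 3) (cell 8) ∷
    minimum 3 (temp 5) (temp 3) ∷
    minimum 0 (cell 8) (num 2 [ inner ]) ∷
    assign 0 (lit 1 ≤ᴵ int 1 [ inner ]) (num 0 [ inner ]) (temp 0) ∷
    set 0 (temp 0 +ᴺ cell 8) ∷
    assign 0 (selected ≤ᴵ inner) (temp 0 +ᴺ temp 4 +ᴺ temp 5) (temp 0) ∷
    set 1 (temp 2 +ᴺ temp 3) ∷
    assign 1 (selected ≤ᴵ inner) (temp 1 +ᴺ cell 8 +ᴺ cell 8) (temp 1) ∷ []

boundsᴮ : Block
boundsᴮ = assign 0 (outer ⊕ lit 1 ≤ᴵ size) (num 1 [ outer ]) (num 2 [ outer ⊖ size ]) ∷ []

-- The first two searches supply the maximisers `θl` and `θu`, from register 6; the last supplies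
-- the maximum itself, from register 7. Registers 4 and 5 survive the later searches.
maximumRegret : Program
maximumRegret =
  maximise (lowerPriceᴮ outer) (lowerPriceᴮ inner ++ dualᴮ) ⨾
  num 4 [ lit 0 ]≔ cell 6 ⨾
  maximise (upperPriceᴮ outer) (upperPriceᴮ inner ++ dualᴮ) ⨾
  num 5 [ lit 0 ]≔ cell 6 ⨾
  maximise boundsᴮ regretᴮ ⨾
  num 3 [ lit 0 ]≔ cell 7

maximumRegretCost : ℕ → ℕ
maximumRegretCost n =
  maximiseCost (lowerPriceᴮ outer) (lowerPriceᴮ inner ++ dualᴮ) n ℕ.+ (4 ℕ.+
  (maximiseCost (upperPriceᴮ outer) (upperPriceᴮ inner ++ dualᴮ) n ℕ.+ (4 ℕ.+
  (maximiseCost boundsᴮ regretᴮ n ℕ.+ 4))))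

maximumRegretCost∈O : maximumRegretCost ∈ O (_^ 2)
maximumRegretCost∈O =
  O-+ 2 (maximiseCost∈O (lowerPriceᴮ outer) (lowerPriceᴮ inner ++ dualᴮ)) (O-+ 2 (O-const 4 2)
  (O-+ 2 (maximiseCost∈O (upperPriceᴮ outer) (upperPriceᴮ inner ++ dualᴮ)) (O-+ 2 (O-const 4 2)
  (O-+ 2 (maximiseCost∈O boundsᴮ regretᴮ) (O-const 4 2)))))

-- Correctness of the program.

module Blocks {c ℓ₁ ℓ₂} (F : OrderedField c ℓ₁ ℓ₂) where
  open Machine F
  open Execution F
  open Formula F

  module _ (σ : State) where
    private
      k = ints σ 3 0

    -- Holds by computation, as the functions of `Formula` use the same conditionals as the blocks.
    lower-dual-run : difference (run (lowerPriceᴮ inner ++ dualᴮ) σ) ≡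
      dualTerm (ints σ 0 1 ≤ᵇ k) (nums σ 8 0) (lowerPrice (nums σ 0 k) (nums σ 1 k))
    lower-dual-run = refl

    upper-dual-run : difference (run (upperPriceᴮ inner ++ dualᴮ) σ) ≡
      dualTerm (ints σ 0 1 ≤ᵇ k) (nums σ 8 0) (upperPrice (ints σ 1 k) (nums σ 0 k) (nums σ 1 k) (nums σ 2 k))
    upper-dual-run = refl

    opaque
      unfolding regretᴮ

      -- The data enter as variables with equations, so that callers replace memory contents without
      -- rewriting inside the unfolded run.
      regret-run : ∀ e ξ C up l u → (ints σ 0 1 ≤ᵇ k) ≡ e → ints σ 1 k ≡ ξ → nums σ 0 k ≡ C → nums σ 2 k ≡ up →
        lowerPrice (nums σ 0 k) (nums σ 1 k) ≡ l →
        upperPrice (ints σ 1 k) (nums σ 0 k) (nums σ 1 k) (nums σ 2 k) ≡ u →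
        difference (run regretᴮ σ) ≡ regretTerm e ξ C up l u (nums σ 4 0) (nums σ 5 0) (nums σ 8 0)
      regret-run _ _ _ _ _ _ refl refl refl refl refl refl = refl

module Correctness {c ℓ₁ ℓ₂} (F : OrderedField c ℓ₁ ℓ₂) {n} (I : Regret.Instance F n)
                   (x : Vector ℕ n) (x∈ : x ∈ FirstStage (Regret.Instance.p I)) where
  open OrderedField F using (Carrier; 0#; _≤_; _≈_)
  open OrderedFieldProperties F
  open Regret F using (IsMaxRegret)
  open Regret.Instance I
  open Machine F
  open Execution F
  open Formula F
  open Thresholds F using (Threshold; FromValues)
  open MaximumRegret F I x x∈
  open Blocks F

  Cₐ lowerₐ upperₐ : ℕ → Carrier
  Cₐ     = load 0# C
  lowerₐ = load 0# lower
  upperₐ = load 0# upper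

  xₐ : ℕ → ℕ
  xₐ = load 0 x

  lₐ uₐ : ℕ → Carrier
  lₐ k = lowerPrice (Cₐ k) (lowerₐ k)
  uₐ k = upperPrice (xₐ k) (Cₐ k) (lowerₐ k) (upperₐ k)

  lₐ-toℕ : ∀ k → lₐ (toℕ k) ≡ l k
  lₐ-toℕ k = ≡.cong₂ lowerPrice (load-toℕ 0# C k) (load-toℕ 0# lower k)

  uₐ-toℕ : ∀ k → uₐ (toℕ k) ≡ u k
  uₐ-toℕ k rewrite load-toℕ 0# C k | load-toℕ 0# lower k | load-toℕ 0# upper k | load-toℕ 0 x k = refl

  σ₀ : State
  σ₀ = input I x

  dual-step : (ℕ → Carrier) → Carrier → ℕ → Carrier
  dual-step v θ k = dualTerm (p ≤ᵇ k) θ (v k)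

  regret-step : (θl θu α : Carrier) → ℕ → Carrier
  regret-step θl θu α k = regretTerm (p ≤ᵇ k) (xₐ k) (Cₐ k) (upperₐ k) (lₐ k) (uₐ k) θl θu α

  bounds : ℕ → Carrier
  bounds k = if k ℕ.+ 1 ≤ᵇ n then lowerₐ k else upperₐ (k ∸ n)

  Loaded : State → Set c
  Loaded = Agree 3 2 σ₀

  module _ {σ} (ag : Loaded σ) where
    lowerPrice-eq : ∀ k → lowerPrice (nums σ 0 k) (nums σ 1 k) ≡ lₐ k
    lowerPrice-eq k = ≡.cong₂ lowerPrice (nums-agree ag (s≤s z≤n) k) (nums-agree ag (s≤s (s≤s z≤n)) k)

    upperPrice-eq : ∀ k → upperPrice (ints σ 1 k) (nums σ 0 k) (nums σ 1 k) (nums σ 2 k) ≡ uₐ k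
    upperPrice-eq k
      rewrite nums-agree ag {0} (s≤s z≤n) k | nums-agree ag {1} (s≤s (s≤s z≤n)) k
        | nums-agree ag {2} (s≤s (s≤s (s≤s z≤n))) k | ints-agree ag {1} (s≤s (s≤s z≤n)) k = refl

    over-eq : ∀ k → (ints σ 0 1 ≤ᵇ k) ≡ (p ≤ᵇ k)
    over-eq k = ≡.cong (_≤ᵇ k) (ints-agree ag (s≤s z≤n) 1)

    lower-dual-loaded : difference (run (lowerPriceᴮ inner ++ dualᴮ) σ) ≡ dual-step lₐ (nums σ 8 0) (ints σ 3 0)
    lower-dual-loaded = ≡.trans (lower-dual-run σ)
      (≡.cong₂ (λ e → dualTerm e (nums σ 8 0)) (over-eq _) (lowerPrice-eq (ints σ 3 0)))

    upper-dual-loaded : difference (run (upperPriceᴮ inner ++ dualᴮ) σ) ≡ dual-step uₐ (nums σ 8 0) (ints σ 3 0)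
    upper-dual-loaded = ≡.trans (upper-dual-run σ)
      (≡.cong₂ (λ e → dualTerm e (nums σ 8 0)) (over-eq _) (upperPrice-eq (ints σ 3 0)))

    regret-loaded : difference (run regretᴮ σ) ≡ regret-step (nums σ 4 0) (nums σ 5 0) (nums σ 8 0) (ints σ 3 0)
    regret-loaded = regret-run σ (p ≤ᵇ k) (xₐ k) (Cₐ k) (upperₐ k) (lₐ k) (uₐ k) (over-eq k)
      (ints-agree ag (s≤s (s≤s z≤n)) k) (nums-agree ag (s≤s z≤n) k)
      (nums-agree ag (s≤s (s≤s (s≤s z≤n))) k) (lowerPrice-eq k) (upperPrice-eq k)
      where
      k = ints σ 3 0

    bounds-loaded : nums (run boundsᴮ σ) 10 0 ≡ bounds (ints σ 2 0)
    bounds-loaded rewrite ints-agree ag {0} (s≤s z≤n) 0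
      | nums-agree ag {1} (s≤s (s≤s z≤n)) (ints σ 2 0)
      | nums-agree ag {2} (s≤s (s≤s (s≤s z≤n))) (ints σ 2 0 ∸ n) = refl

  -- The machine associates to the left and `sum` to the right, so only `_≈_` can hold; `shift`
  -- moves the first summand to the front.
  partialSum≈sum : ∀ {n} (f : ℕ → Carrier) (g : Vector Carrier n) → (∀ k → f (toℕ k) ≡ g k) →
    partialSum f n ≈ sum g
  partialSum≈sum {zero}  f g eq = ≈-refl
  partialSum≈sum {suc n} f g eq = ≈-trans (shift n)
    (+-cong (≡⇒≈ (eq zero)) (partialSum≈sum (f ∘ suc) (tail g) (eq ∘ suc)))
    where
    open OrderedField F using (_+_)
    shift : ∀ m → partialSum f (suc m) ≈ f 0 + partialSum (f ∘ suc) m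
    shift zero    = +-comm _ _
    shift (suc m) = ≈-trans (+-congʳ (shift m)) (+-assoc _ _ _)

  dual-sum : ∀ {vₐ v} → (∀ k → vₐ (toℕ k) ≡ v k) → ∀ θ → partialSum (dual-step vₐ θ) n ≈ dual v θ
  dual-sum eq θ = partialSum≈sum _ _ λ k → ≡.cong (dualTerm (over k) θ) (eq k)

  HasThreshold : Vector Carrier n → Carrier → Set _
  HasThreshold v θ = ∃[ y ] y ∈ Recourse p 0ᵛ × Threshold 0ᵛ y v θ

  -- Padding entries may even win the search: `dual-maximiser` needs a `θ*` no worse than the
  -- prices, not one among them.
  best-threshold : ∀ {vₐ v σ} → (∀ k → vₐ (toℕ k) ≡ v k) → (∀ k → 0# ≤ v k) →
    IsBest vₐ (λ θ → partialSum (dual-step vₐ θ) n) (n ℕ.+ n) σ →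
    HasThreshold v (nums σ 6 0)
  best-threshold {vₐ} {v} {σ} eq 0≤v (best , at0 , at) = dual-maximiser v 0≤v (nums σ 6 0) λ where
      (inj₁ refl)       → transport at0
      (inj₂ (k , refl)) → ≡.subst (λ θ → dual v θ ≤ dual v (nums σ 6 0)) (eq k)
        (transport (at (ℕ.≤-trans (Fin.toℕ<n k) (ℕ.m≤m+n n n))))
    where
    transport : ∀ {θ} → partialSum (dual-step vₐ θ) n ≤ nums σ 7 0 → dual v θ ≤ dual v (nums σ 6 0)
    transport {θ} h = ≤-respˡ-≈ (dual-sum eq θ) (≤-respʳ-≈ (dual-sum eq (nums σ 6 0)) (≡.subst (_ ≤_) best h))

  bounds-lower : ∀ k → bounds (toℕ k) ≡ lower k
  bounds-lower k rewrite ≤⇒≤ᵇ-true (≡.subst (ℕ._≤ n) (ℕ.+-comm 1 (toℕ k)) (Fin.toℕ<n k)) = load-toℕ 0# lower k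

  bounds-upper : ∀ k → bounds (n ℕ.+ toℕ k) ≡ upper k
  bounds-upper k rewrite <⇒≤ᵇ-false (ℕ.≤-trans (s≤s (ℕ.m≤m+n n (toℕ k))) (ℕ.≤-reflexive (ℕ.+-comm 1 (n ℕ.+ toℕ k))))
    | ℕ.m+n∸m≡n n (toℕ k) = load-toℕ 0# upper k

  IsMaxRegret-resp : ∀ {v w} → v ≈ w → IsMaxRegret I x w → IsMaxRegret I x v
  IsMaxRegret-resp v≈w ((s , inc , opt , s∈U , isInc , isOpt , w≈) , max) =
    (s , inc , opt , s∈U , isInc , isOpt , ≈-trans v≈w w≈) , λ att → ≤-respʳ-≈ (≈-sym v≈w) (max att)

  module _ {θl θu} {yl yu : Vector ℕ n} (yl∈R : yl ∈ Recourse p 0ᵛ) (thr-l : Threshold 0ᵛ yl l θl)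
           (yu∈R : yu ∈ Recourse p 0ᵛ) (thr-u : Threshold 0ᵛ yu u θu) where

    private
      value V : Carrier → Carrier
      value α = partialSum (regret-step θl θu α) n
      V = regret yl∈R thr-l yu∈R thr-u

    value≈regret : ∀ α → value α ≈ V α
    value≈regret α = partialSum≈sum _ _ eq
      where
      eq : ∀ k → regret-step θl θu α (toℕ k) ≡ regretTerms yl∈R thr-l yu∈R thr-u α k
      eq k rewrite load-toℕ 0# C k | load-toℕ 0# lower k | load-toℕ 0# upper k | load-toℕ 0 x k = refl

    -- The arguments tried, `0#` and all interval bounds, are exactly those at which `regret-max`
    -- demands a comparison.
    best-regret : ∀ {σ} → IsBest bounds value (n ℕ.+ n) σ → IsMaxRegret I x (nums σ 7 0)
    best-regret {σ} (best , at0 , at) =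
      IsMaxRegret-resp best≈ (regret-max yl∈R thr-l yu∈R thr-u (nums σ 6 0) (transport at0) at-lower at-upper)
      where
      best≈ : nums σ 7 0 ≈ V (nums σ 6 0)
      best≈ = ≡.subst (_≈ V (nums σ 6 0)) (≡.sym best) (value≈regret (nums σ 6 0))
      transport : ∀ {α} → value α ≤ nums σ 7 0 → V α ≤ V (nums σ 6 0)
      transport {α} h = ≤-respˡ-≈ (value≈regret α) (≤-respʳ-≈ best≈ h)
      at-lower : ∀ k → V (lower k) ≤ V (nums σ 6 0)
      at-lower k = ≡.subst (λ α → V α ≤ V (nums σ 6 0)) (bounds-lower k)
        (transport (at (ℕ.≤-trans (Fin.toℕ<n k) (ℕ.m≤m+n n n))))
      at-upper : ∀ k → V (upper k) ≤ V (nums σ 6 0)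
      at-upper k = ≡.subst (λ α → V α ≤ V (nums σ 6 0)) (bounds-upper k)
        (transport (at (ℕ.+-monoʳ-< n (Fin.toℕ<n k))))

  runs-maximumRegret : Runs maximumRegret σ₀ (maximumRegretCost n) (λ σ → IsMaxRegret I x (nums σ 3 0))
  runs-maximumRegret =
    runs-seq (runs-maximise (lowerPriceᴮ outer) (lowerPriceᴮ inner ++ dualᴮ) lₐ (dual-step lₐ) refl
      (λ ag → lowerPrice-eq (loaded ag) _) (λ ag → lower-dual-loaded (loaded ag))) λ {σ₁} (ag₁ , best₁) →
    runs-seq {Φ = λ σ → Agree 4 2 σ₀ σ × HasThreshold l (nums σ 4 0)}
      (runs-num (agree-num 4 ℕ.≤-refl (agree-weaken (ℕ.m≤m+n 4 2) ℕ.≤-refl ag₁)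
        , best-threshold {σ = σ₁} lₐ-toℕ 0≤l best₁)) λ {σ₂} (ag₂ , thr-l) →
    runs-seq (runs-maximise (upperPriceᴮ outer) (upperPriceᴮ inner ++ dualᴮ) uₐ (dual-step uₐ)
        (ints-agree ag₂ (s≤s z≤n) 0)
      (λ ag → upperPrice-eq (loaded′ ag₂ ag) _) (λ ag → upper-dual-loaded (loaded′ ag₂ ag))) λ {σ₃} (ag₃ , best₃) →
    runs-seq {Φ = λ σ → Agree 4 2 σ₀ σ × HasThreshold l (nums σ 4 0) × HasThreshold u (nums σ 5 0)}
      (runs-num (agree-num 5 (ℕ.m≤m+n 4 1) (agree-trans ag₂ (agree-weaken (ℕ.m≤m+n 4 2) ℕ.≤-refl ag₃))
        , ≡.subst (HasThreshold l) (≡.sym (nums-agree ag₃ (ℕ.m≤m+n 5 1) 0)) thr-l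
        , best-threshold {σ = σ₃} uₐ-toℕ 0≤u best₃)) λ {σ₄} (ag₄ , (yl , yl∈R , thr-l) , (yu , yu∈R , thr-u)) →
    runs-seq (runs-maximise boundsᴮ regretᴮ bounds (regret-step (nums σ₄ 4 0) (nums σ₄ 5 0))
        (ints-agree ag₄ (s≤s z≤n) 0)
      (λ ag → bounds-loaded (loaded′ ag₄ ag))
      (λ {σ} ag → ≡.trans (regret-loaded (loaded′ ag₄ ag))
        (≡.cong₂ (λ θl θu → regret-step θl θu (nums σ 8 0) (ints σ 3 0))
          (nums-agree ag (ℕ.m≤m+n 5 1) 0) (nums-agree ag ℕ.≤-refl 0)))) λ {σ₅} (_ , best₅) →
    runs-num (best-regret yl∈R thr-l yu∈R thr-u {σ₅} best₅)
    where
    loaded : ∀ {σ} → Agree 6 2 σ₀ σ → Loaded σ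
    loaded = agree-weaken (ℕ.m≤m+n 3 3) ℕ.≤-refl
    loaded′ : ∀ {σ σ′} → Agree 4 2 σ₀ σ → Agree 6 2 σ σ′ → Loaded σ′
    loaded′ ag ag′ = agree-trans (agree-weaken (ℕ.m≤m+n 3 1) ℕ.≤-refl ag) (agree-weaken (ℕ.m≤m+n 3 3) ℕ.≤-refl ag′)

open import Data.Nat using (_≤_)

theorem4 : ∀ {c ℓ₁ ℓ₂} (F : OrderedField c ℓ₁ ℓ₂) →
  let open Regret F
      open Machine F
  in ∃[ P ] ∃[ T ] T ∈ O (λ n → n ^ 2) ×
     (∀ {n} (I : Instance n) (x : Vector ℕ n) → x ∈ FirstStage (Instance.p I) →
      ∃[ σ ] ∃[ t ] ⟨ P , input I x ⟩⇓ σ in-time t × t ≤ T n ×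
        IsMaxRegret I x (output σ))
theorem4 F = maximumRegret , maximumRegretCost , maximumRegretCost∈O ,
  λ I x x∈ → Correctness.runs-maximumRegret F I x x∈
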